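{- For every natural number $r \geq 3$ there is a constant $c(r)>0$ such that the following holds. Let $p,\epsilon$ be constants with $0<\epsilon<1$ and $0<p<1$, and let $n$ be sufficiently large depending on $r$, $p$ and $\epsilon$. If an $n$-vertex graph $G$ satisfies $\mathcal{P}^*_{K_r,p}(\delta)$ with $\delta = c(r)\, p^{2r^2}\epsilon$, then $G$ also satisfies $\mathcal{P}^*_{K_2,p}(\epsilon)$.
   Context: For a graph $H$ with $r$ vertices and $m$ edges, a labeled copy of $H$ in a graph $G$ is an injective map $\varphi: V(H)\to V(G)$ such that $\varphi(u)\varphi(v)\in E(G)$ whenever $uv\in E(H)$; it lies in $S\subseteq V(G)$ if its image is contained in $S$. An $n$-vertex graph $G$ satisfies $\mathcal{P}^*_{H,p}(\epsilon)$ if for every subset $S\subseteq V(G)$ the number of labeled copies of $H$ in the induced subgraph $G[S]$ is within $\epsilon n^r$ of $p^m|S|^r$. Here $K_r$ is the complete graph on $r$ vertices; in particular $\mathcal{P}^*_{K_2,p}(\epsilon)$ says every $S$ spans a number of ordered pairs $(x,y)$ with $xy\in E(G)$ within $\epsilon n^2$ of $p|S|^2$.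
   Formalization: The constants p and ε are taken to be rational numbers in (0,1) rather than arbitrary real numbers; the constant c(r) is produced as a positive rational. -}

module Defs where

open import Data.Bool using (Bool; true; false; _∧_; _∨_; not; if_then_else_)
open import Data.Nat using (ℕ; zero; suc)
open import Data.Nat.Combinatorics using (_C_)
open import Data.Fin using (Fin; _≟_)
open import Data.Fin.Subset using (Subset; ∣_∣)
open import Data.Vec using (Vec; []; _∷_; lookup)
open import Data.List using (List; [_]; map; concatMap; allFin)
open import Data.Bool.ListAction using (all)
open import Data.Nat.ListAction using (sum)
open import Data.Integer using (+_)
open import Data.Rational using (ℚ; _/_; _*_; _-_; _≤_; 1ℚ) renaming (∣_∣ to absℚ)
open import Relation.Binary.PropositionalEquality using (_≡_)
open import Relation.Nullary.Decidable using (⌊_⌋)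

record Graph (n : ℕ) : Set where
  field
    adj     : Fin n → Fin n → Bool
    adj-sym : ∀ i j → adj i j ≡ adj j i
    irrefl  : ∀ i → adj i i ≡ false
open Graph public

ℕ→ℚ : ℕ → ℚ
ℕ→ℚ k = + k / 1

_^ℚ_ : ℚ → ℕ → ℚ
x ^ℚ zero  = 1ℚ
x ^ℚ suc k = x * (x ^ℚ k)

_∈ᵇ_ : ∀ {n} → Fin n → Subset n → Bool
i ∈ᵇ S = lookup S i

maps : (n r : ℕ) → List (Vec (Fin n) r)
maps n zero    = [ [] ]
maps n (suc r) = concatMap (λ x → map (x ∷_) (maps n r)) (allFin n)

isKrCopyIn : ∀ {n r} → Graph n → Subset n → Vec (Fin n) r → Bool
isKrCopyIn {n} {r} G S φ =
  all (λ u → lookup φ u ∈ᵇ S) (allFin r)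
  ∧ all (λ u → all (λ v →
        ⌊ u ≟ v ⌋ ∨ (not ⌊ lookup φ u ≟ lookup φ v ⌋ ∧ adj G (lookup φ u) (lookup φ v)))
      (allFin r)) (allFin r)

copiesK : ∀ {n} → Graph n → Subset n → ℕ → ℕ
copiesK {n} G S r = sum (map (λ φ → if isKrCopyIn G S φ then 1 else 0) (maps n r))

PstarK : ∀ {n} → Graph n → (r : ℕ) → (p ε : ℚ) → Set
PstarK {n} G r p ε =
  (S : Subset n) →
  absℚ (ℕ→ℚ (copiesK G S r) - (p ^ℚ (r C 2)) * (ℕ→ℚ ∣ S ∣ ^ℚ r)) ≤ ε * (ℕ→ℚ n ^ℚ r)

{-# OPTIONS --safe #-}
-- Averages over the vertices are normalised, so K A j f is the density of j-cliques weighted by f.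
-- Polarising the hypothesis (the K_r-discrepancy is multi-affine in the vertex weights) shows that for every
-- weight f most vertices x satisfy K_{r-1}(f restricted to N(x)) ≈ p^(r choose 2) (E f)^{r-1}, with an L¹ error
-- linear in δ.  Applying this to f restricted to N(z) and exchanging the roles of x and z gives
-- d_f(x)^{r-1} ≈ d_f(z)^{r-1} for most pairs x, z, where d_f(x) is the f-weighted degree.  For f ≥ 1/4 the
-- degrees are large on average, so d_f itself is nearly constant, and by linearity so is d_u for every
-- 0 ≤ u ≤ 1.  Hence A is quasirandom with some density q; counting r-cliques once more forces q ≈ p.
module Submission where

open import Defs
open import Data.Nat as ℕ using (ℕ; zero; suc)
import Data.Nat.Properties as ℕₚ
open import Data.Nat.Combinatorics using (_C_; nCk+nC[k+1]≡[n+1]C[k+1]; nC1≡n)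
open import Data.Nat.Coprimality using (1-coprimeTo) renaming (sym to coprime-sym)
open import Data.Nat.ListAction using () renaming (sum to sumℕ)
open import Data.Nat.ListAction.Properties using (sum-++)
open import Data.Nat.Solver using () renaming (module +-*-Solver to ℕ-Solver)
open import Data.Integer as ℤ using ()
import Data.Integer.Properties as ℤₚ
open import Data.Bool using (Bool; true; false; if_then_else_; _∧_; _∨_; not; T)
open import Data.Bool.ListAction using (all)
open import Data.Fin using (Fin; zero; suc; _≟_)
open import Data.Fin.Properties using (suc-injective)
open import Data.Fin.Subset using (Subset; ⊤) renaming (∣_∣ to card)
open import Data.List as List using (List; []; _∷_; concatMap)
import Data.List.Properties as Listₚ
open import Data.Vec as Vec using (Vec; []; _∷_; lookup)
open import Data.Vec.Functional as F using ()
open import Data.Vec.Properties using (lookup∘tabulate; lookup-replicate)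
open import Data.Rational hiding (_≟_; floor)
open import Data.Rational.Properties hiding (_≟_)
open import Data.Rational.Solver using (module +-*-Solver)
open import Data.Product using (Σ; _×_; _,_; proj₁; proj₂)
open import Data.Sum using (inj₁; inj₂)
open import Data.Unit using (tt)
open import Algebra.Bundles using (CommutativeRing)
open import Algebra.Properties.Semiring.Sum (CommutativeRing.semiring +-*-commutativeRing)
  using (sum; sum-cong-≗; ∑-distrib-+; *-distribˡ-sum; ∑-comm)
open import Function using (_∘_; id)
open import Relation.Binary.PropositionalEquality
open import Relation.Nullary using (does; yes; no)
open import Relation.Nullary.Decidable using (⌊_⌋)
open import Relation.Nullary.Negation using (contradiction)
open +-*-Solver

-- Rational arithmetic

-- Every error has to stay linear in δ, because δ is linear in ε. A difference quotient in a
-- direction h would balance M/s against s and cost a square root. But s ↦ discrepancy of f + s h is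
-- a polynomial of degree at most r that is bounded by M on all of [0,1], so its linear coefficient
-- is at most a constant depending on r times M. Base weight and direction are kept in [0,1/2] so
-- that f + s h remains a weight. Individual degrees have no lower bound; only their averaged powers
-- do. Two degrees are therefore compared through a third vertex that is averaged out. The weights
-- 1/4 + u/4 lie in [1/4,1/2], where both restrictions hold, and u is recovered from two of them.
-- The loss in p, with m = r(r-1)/2 and P = p^m: one factor P from comparing degree powers, one from
-- the lower bound on their average, and p^(m-1) from turning q^m ≈ p^m into q ≈ p. The total
-- exponent 3m - 1 is at most 2r². The size of n pays for the diagonal: (E f)^j also counts tuples
-- with repeated vertices, an error of order 1/n.

0≤1 : 0ℚ ≤ 1ℚ
0≤1 = nonNegative⁻¹ 1ℚ

0≤+ : ∀ {a b} → 0ℚ ≤ a → 0ℚ ≤ b → 0ℚ ≤ a + b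
0≤+ = +-mono-≤

*-mono : ∀ {a b c d} → 0ℚ ≤ a → a ≤ b → 0ℚ ≤ c → c ≤ d → a * c ≤ b * d
*-mono {a} {b} {c} {d} 0≤a a≤b 0≤c c≤d = ≤-trans
  (*-monoʳ-≤-nonNeg c {{nonNegative 0≤c}} a≤b)
  (*-monoˡ-≤-nonNeg b {{nonNegative (≤-trans 0≤a a≤b)}} c≤d)

*-monoˡ : ∀ {a b} c → 0ℚ ≤ c → a ≤ b → c * a ≤ c * b
*-monoˡ c 0≤c = *-monoˡ-≤-nonNeg c {{nonNegative 0≤c}}

*-monoʳ : ∀ {a b} c → 0ℚ ≤ c → a ≤ b → a * c ≤ b * c
*-monoʳ c 0≤c = *-monoʳ-≤-nonNeg c {{nonNegative 0≤c}}

0≤* : ∀ {a b} → 0ℚ ≤ a → 0ℚ ≤ b → 0ℚ ≤ a * b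
0≤* {a} 0≤a 0≤b = ≤-trans (≤-reflexive (sym (*-zeroʳ a))) (*-monoˡ a 0≤a 0≤b)

*≤ˡ : ∀ {a c} → 0ℚ ≤ a → c ≤ 1ℚ → a * c ≤ a
*≤ˡ {a} 0≤a c≤1 = ≤-trans (*-monoˡ a 0≤a c≤1) (≤-reflexive (*-identityʳ a))

0≤d : ∀ {a b} → a ≤ b → 0ℚ ≤ b - a
0≤d {a} {b} a≤b = subst (_≤ b - a) (+-inverseʳ a) (+-monoˡ-≤ (- a) a≤b)

≤-diff : ∀ {a b e} → b - a ≡ e → 0ℚ ≤ e → a ≤ b
≤-diff {a} {b} refl 0≤e = subst₂ _≤_ (+-identityˡ a)
  (solve 2 (λ a b → b :- a :+ a := b) refl a b) (+-monoˡ-≤ a 0≤e)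

x≤∣x∣ : ∀ x → x ≤ ∣ x ∣
x≤∣x∣ x with ≤-total 0ℚ x
... | inj₁ 0≤x = ≤-reflexive (sym (0≤p⇒∣p∣≡p 0≤x))
... | inj₂ x≤0 = ≤-trans x≤0 (0≤∣p∣ x)

-x≤∣x∣ : ∀ x → - x ≤ ∣ x ∣
-x≤∣x∣ x = subst (- x ≤_) (∣-p∣≡∣p∣ x) (x≤∣x∣ (- x))

abs≤ : ∀ {x c} → x ≤ c → - x ≤ c → ∣ x ∣ ≤ c
abs≤ {x} x≤c -x≤c with ∣p∣≡p∨∣p∣≡-p x
... | inj₁ e = subst (_≤ _) (sym e) x≤c
... | inj₂ e = subst (_≤ _) (sym e) -x≤c

neg-sub : ∀ a b → - (a - b) ≡ b - a
neg-sub = solve 2 (λ a b → :- (a :- b) := b :- a) refl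

abs-sym : ∀ a b → ∣ a - b ∣ ≡ ∣ b - a ∣
abs-sym a b = trans (sym (∣-p∣≡∣p∣ (a - b))) (cong ∣_∣ (neg-sub a b))

triangle : ∀ a b c → ∣ a - c ∣ ≤ ∣ a - b ∣ + ∣ b - c ∣
triangle a b c = ≤-trans
  (≤-reflexive (cong ∣_∣ (solve 3 (λ a b c → a :- c := (a :- b) :+ (b :- c)) refl a b c)))
  (∣p+q∣≤∣p∣+∣q∣ (a - b) (b - c))

∣*∣ˡ : ∀ c x → 0ℚ ≤ c → ∣ c * x ∣ ≡ c * ∣ x ∣
∣*∣ˡ c x 0≤c = trans (∣p*q∣≡∣p∣*∣q∣ c x) (cong (_* ∣ x ∣) (0≤p⇒∣p∣≡p 0≤c))

^-nonneg : ∀ {a} → 0ℚ ≤ a → ∀ j → 0ℚ ≤ a ^ℚ j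
^-nonneg 0≤a zero    = 0≤1
^-nonneg 0≤a (suc j) = 0≤* 0≤a (^-nonneg 0≤a j)

^-mono : ∀ {a b} → 0ℚ ≤ a → a ≤ b → ∀ j → a ^ℚ j ≤ b ^ℚ j
^-mono 0≤a a≤b zero    = ≤-refl
^-mono 0≤a a≤b (suc j) = *-mono 0≤a a≤b (^-nonneg 0≤a j) (^-mono 0≤a a≤b j)

^≤1 : ∀ {a} → 0ℚ ≤ a → a ≤ 1ℚ → ∀ j → a ^ℚ j ≤ 1ℚ
^≤1 0≤a a≤1 zero    = ≤-refl
^≤1 0≤a a≤1 (suc j) = *-mono 0≤a a≤1 (^-nonneg 0≤a j) (^≤1 0≤a a≤1 j)

^-pos : ∀ {a} → 0ℚ < a → ∀ j → 0ℚ < a ^ℚ j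
^-pos 0<a zero    = positive⁻¹ 1ℚ
^-pos {a} 0<a (suc j) = positive⁻¹ _ {{pos*pos⇒pos a {{positive 0<a}} (a ^ℚ j) {{positive (^-pos 0<a j)}}}}

^-+ : ∀ a i j → a ^ℚ (i ℕ.+ j) ≡ a ^ℚ i * a ^ℚ j
^-+ a zero    j = sym (*-identityˡ _)
^-+ a (suc i) j = trans (cong (a *_) (^-+ a i j)) (sym (*-assoc a _ _))

*-^ : ∀ a b j → (a * b) ^ℚ j ≡ a ^ℚ j * b ^ℚ j
*-^ a b zero    = refl
*-^ a b (suc j) = trans (cong (a * b *_) (*-^ a b j))
  (solve 4 (λ a b c d → a :* b :* (c :* d) := a :* c :* (b :* d)) refl a b (a ^ℚ j) (b ^ℚ j))

^-antimono : ∀ {a} → 0ℚ ≤ a → a ≤ 1ℚ → ∀ {i j} → i ℕ.≤ j → a ^ℚ j ≤ a ^ℚ i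
^-antimono 0≤a a≤1 {j = j} ℕ.z≤n = ^≤1 0≤a a≤1 j
^-antimono {a} 0≤a a≤1 (ℕ.s≤s i≤j) = *-monoˡ a 0≤a (^-antimono 0≤a a≤1 i≤j)

ℕ→ℚ-mkℚ : ∀ k → ℕ→ℚ k ≡ mkℚ (ℤ.+ k) 0 (coprime-sym (1-coprimeTo k))
ℕ→ℚ-mkℚ k = normalize-coprime (coprime-sym (1-coprimeTo k))

ℕ→ℚ-+ : ∀ a b → ℕ→ℚ (a ℕ.+ b) ≡ ℕ→ℚ a + ℕ→ℚ b
ℕ→ℚ-+ a b rewrite ℕ→ℚ-mkℚ a | ℕ→ℚ-mkℚ b =
  cong (_/ 1) (sym (cong₂ ℤ._+_ (ℤₚ.*-identityʳ (ℤ.+ a)) (ℤₚ.*-identityʳ (ℤ.+ b))))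

ℕ→ℚ-suc : ∀ a → ℕ→ℚ (suc a) ≡ 1ℚ + ℕ→ℚ a
ℕ→ℚ-suc a = ℕ→ℚ-+ 1 a

ℕ→ℚ-nonneg : ∀ a → 0ℚ ≤ ℕ→ℚ a
ℕ→ℚ-nonneg zero    = ≤-refl
ℕ→ℚ-nonneg (suc a) = subst (0ℚ ≤_) (sym (ℕ→ℚ-suc a)) (0≤+ 0≤1 (ℕ→ℚ-nonneg a))

ℕ→ℚ-mono : ∀ {a b} → a ℕ.≤ b → ℕ→ℚ a ≤ ℕ→ℚ b
ℕ→ℚ-mono {a} {b} a≤b = subst₂ _≤_ (+-identityʳ (ℕ→ℚ a))
  (trans (sym (ℕ→ℚ-+ a (b ℕ.∸ a))) (cong ℕ→ℚ (ℕₚ.m+[n∸m]≡n a≤b)))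
  (+-monoʳ-≤ (ℕ→ℚ a) (ℕ→ℚ-nonneg (b ℕ.∸ a)))

Unit : ℚ → Set
Unit a = 0ℚ ≤ a × a ≤ 1ℚ

^-lipschitz : ∀ {a b} → Unit a → Unit b → ∀ j → ∣ a ^ℚ j - b ^ℚ j ∣ ≤ ℕ→ℚ j * ∣ a - b ∣
^-lipschitz {a} {b} ua ub zero = ≤-reflexive (sym (*-zeroˡ ∣ a - b ∣))
^-lipschitz {a} {b} ua@(0≤a , a≤1) ub@(0≤b , b≤1) (suc j) = begin
  ∣ a * x - b * y ∣                       ≡⟨ cong ∣_∣ (solve 4 (λ a b x y → a :* x :- b :* y := a :* (x :- y) :+ y :* (a :- b)) refl a b x y) ⟩
  ∣ a * (x - y) + y * (a - b) ∣           ≤⟨ ∣p+q∣≤∣p∣+∣q∣ (a * (x - y)) (y * (a - b)) ⟩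
  ∣ a * (x - y) ∣ + ∣ y * (a - b) ∣       ≡⟨ cong₂ _+_ (∣*∣ˡ a _ 0≤a) (∣*∣ˡ y _ (^-nonneg 0≤b j)) ⟩
  a * ∣ x - y ∣ + y * ∣ a - b ∣           ≤⟨ +-mono-≤ (*-monoʳ _ (0≤∣p∣ _) a≤1) (*-monoʳ _ (0≤∣p∣ _) (^≤1 0≤b b≤1 j)) ⟩
  1ℚ * ∣ x - y ∣ + 1ℚ * ∣ a - b ∣         ≤⟨ +-monoˡ-≤ _ (*-monoˡ 1ℚ 0≤1 (^-lipschitz ua ub j)) ⟩
  1ℚ * (ℕ→ℚ j * ∣ a - b ∣) + 1ℚ * ∣ a - b ∣ ≡⟨ solve 2 (λ j d → con 1ℚ :* (j :* d) :+ con 1ℚ :* d := (con 1ℚ :+ j) :* d) refl (ℕ→ℚ j) ∣ a - b ∣ ⟩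
  (1ℚ + ℕ→ℚ j) * ∣ a - b ∣                ≡⟨ cong (_* ∣ a - b ∣) (sym (ℕ→ℚ-suc j)) ⟩
  ℕ→ℚ (suc j) * ∣ a - b ∣ ∎
  where
  open ≤-Reasoning
  x = a ^ℚ j
  y = b ^ℚ j

-- Write a^(k+1) - b^(k+1) as (a - b) b^k + a (a^k - b^k), whose two summands have the same sign.
-- The factor involves `b` alone, so a very small `a` does no harm.
^-separates : ∀ {a b} → 0ℚ ≤ a → 0ℚ ≤ b → ∀ k → ∣ a - b ∣ * b ^ℚ k ≤ ∣ a ^ℚ suc k - b ^ℚ suc k ∣
^-separates {a} {b} 0≤a 0≤b k with ≤-total b a
... | inj₁ b≤a = begin
  ∣ a - b ∣ * b ^ℚ k        ≡⟨ cong (_* b ^ℚ k) (0≤p⇒∣p∣≡p (0≤d b≤a)) ⟩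
  (a - b) * b ^ℚ k          ≤⟨ ≤-diff (solve 4 (λ a b x y → (a :* x :- b :* y) :- (a :- b) :* y := a :* (x :- y)) refl a b (a ^ℚ k) (b ^ℚ k))
                                 (0≤* 0≤a (0≤d (^-mono 0≤b b≤a k))) ⟩
  a ^ℚ suc k - b ^ℚ suc k   ≤⟨ x≤∣x∣ _ ⟩
  ∣ a ^ℚ suc k - b ^ℚ suc k ∣ ∎
  where open ≤-Reasoning
... | inj₂ a≤b = begin
  ∣ a - b ∣ * b ^ℚ k        ≡⟨ cong (_* b ^ℚ k) (trans (abs-sym a b) (0≤p⇒∣p∣≡p (0≤d a≤b))) ⟩
  (b - a) * b ^ℚ k          ≤⟨ ≤-diff (solve 4 (λ a b x y → (:- (a :* x :- b :* y)) :- (b :- a) :* y := a :* (y :- x)) refl a b (a ^ℚ k) (b ^ℚ k))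
                                 (0≤* 0≤a (0≤d (^-mono 0≤a a≤b k))) ⟩
  - (a ^ℚ suc k - b ^ℚ suc k) ≤⟨ -x≤∣x∣ _ ⟩
  ∣ a ^ℚ suc k - b ^ℚ suc k ∣ ∎
  where open ≤-Reasoning

-- Normalised clique densities

recip : ℕ → ℚ
recip zero    = 0ℚ
recip (suc m) = 1/ mkℚ (ℤ.+ suc m) 0 (coprime-sym (1-coprimeTo (suc m)))

recip-inverse : ∀ n .{{_ : ℕ.NonZero n}} → ℕ→ℚ n * recip n ≡ 1ℚ
recip-inverse (suc m) = trans (cong (_* recip (suc m)) (ℕ→ℚ-mkℚ (suc m)))
  (*-inverseʳ (mkℚ (ℤ.+ suc m) 0 (coprime-sym (1-coprimeTo (suc m)))))

recip-nonneg : ∀ n → 0ℚ ≤ recip n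
recip-nonneg zero    = ≤-refl
recip-nonneg (suc m) = nonNegative⁻¹ (recip (suc m))

Weight : ℕ → Set
Weight n = Fin n → ℚ

variable
  n : ℕ

E : Weight n → ℚ
E {n} f = recip n * sum f

E-cong : {f g : Weight n} → (∀ x → f x ≡ g x) → E f ≡ E g
E-cong {n} f≗g = cong (recip n *_) (sum-cong-≗ f≗g)

E-+ : (f g : Weight n) → E (λ x → f x + g x) ≡ E f + E g
E-+ {n} f g = trans (cong (recip n *_) (∑-distrib-+ f g)) (*-distribˡ-+ (recip n) (sum f) (sum g))

E-* : (c : ℚ) (f : Weight n) → E (λ x → c * f x) ≡ c * E f
E-* {n} c f = trans (cong (recip n *_) (sym (*-distribˡ-sum c f)))
  (solve 3 (λ a b c → a :* (b :* c) := b :* (a :* c)) refl (recip n) c (sum f))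

E-*ʳ : (c : ℚ) (f : Weight n) → E (λ x → f x * c) ≡ E f * c
E-*ʳ c f = trans (E-cong (λ x → *-comm (f x) c)) (trans (E-* c f) (*-comm c (E f)))

neg≡-1* : ∀ a → - a ≡ - 1ℚ * a
neg≡-1* = solve 1 (λ a → :- a := con (- 1ℚ) :* a) refl

E-sub : (f g : Weight n) → E (λ x → f x - g x) ≡ E f - E g
E-sub f g = trans (E-+ f (λ x → - g x))
  (cong (E f +_) (trans (E-cong (λ x → neg≡-1* (g x))) (trans (E-* (- 1ℚ) g) (sym (neg≡-1* (E g))))))

sum-const : ∀ n c → sum {n} (λ _ → c) ≡ ℕ→ℚ n * c
sum-const zero    c = sym (*-zeroˡ c)
sum-const (suc n) c = trans (cong (_+_ c) (sum-const n c)) (trans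
  (solve 2 (λ a c → c :+ a :* c := (con 1ℚ :+ a) :* c) refl (ℕ→ℚ n) c) (cong (_* c) (sym (ℕ→ℚ-suc n))))

E-const : .{{_ : ℕ.NonZero n}} → ∀ c → E {n} (λ _ → c) ≡ c
E-const {n} c = begin
  recip n * sum {n} (λ _ → c) ≡⟨ cong (recip n *_) (sum-const n c) ⟩
  recip n * (ℕ→ℚ n * c)       ≡⟨ solve 3 (λ r a c → r :* (a :* c) := a :* r :* c) refl (recip n) (ℕ→ℚ n) c ⟩
  ℕ→ℚ n * recip n * c         ≡⟨ cong (_* c) (recip-inverse n) ⟩
  1ℚ * c                      ≡⟨ *-identityˡ c ⟩
  c ∎
  where open ≡-Reasoning

sum-mono : ∀ {n} {f g : Weight n} → (∀ x → f x ≤ g x) → sum f ≤ sum g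
sum-mono {zero}  f≤g = ≤-refl
sum-mono {suc n} f≤g = +-mono-≤ (f≤g zero) (sum-mono (λ x → f≤g (suc x)))

E-mono : {f g : Weight n} → (∀ x → f x ≤ g x) → E f ≤ E g
E-mono {n} f≤g = *-monoˡ (recip n) (recip-nonneg n) (sum-mono f≤g)

E-upper : .{{_ : ℕ.NonZero n}} → ∀ {c} {f : Weight n} → (∀ x → f x ≤ c) → E f ≤ c
E-upper {c = c} f≤c = ≤-trans (E-mono f≤c) (≤-reflexive (E-const c))

E-nonneg : {f : Weight n} → (∀ x → 0ℚ ≤ f x) → 0ℚ ≤ E f
E-nonneg {n} {f} 0≤f = ≤-trans
  (≤-reflexive (trans (sym (*-zeroˡ (E f))) (sym (E-* 0ℚ f))))
  (E-mono (λ x → ≤-trans (≤-reflexive (*-zeroˡ (f x))) (0≤f x)))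

E-abs : (f : Weight n) → ∣ E f ∣ ≤ E (λ x → ∣ f x ∣)
E-abs f = abs≤ (E-mono (λ x → x≤∣x∣ (f x))) (≤-trans
  (≤-reflexive (trans (neg≡-1* (E f)) (sym (E-* (- 1ℚ) f))))
  (E-mono (λ x → ≤-trans (≤-reflexive (sym (neg≡-1* (f x)))) (-x≤∣x∣ (f x)))))

E-swap : (F : Fin n → Fin n → ℚ) → E (λ x → E (F x)) ≡ E (λ y → E (λ x → F x y))
E-swap {n} F = cong (recip n *_) (trans (sym (*-distribˡ-sum (recip n) (λ x → sum (F x))))
  (trans (cong (recip n *_) (∑-comm F)) (*-distribˡ-sum (recip n) (λ y → sum (λ x → F x y)))))

UnitW : Weight n → Set
UnitW f = ∀ x → Unit (f x)

infixl 7 _⊙_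
_⊙_ : Weight n → Weight n → Weight n
(f ⊙ g) x = f x * g x

Unit-* : ∀ {a b} → Unit a → Unit b → Unit (a * b)
Unit-* (0≤a , a≤1) (0≤b , b≤1) = 0≤* 0≤a 0≤b , *-mono 0≤a a≤1 0≤b b≤1

Unit-^ : ∀ {a} → Unit a → ∀ j → Unit (a ^ℚ j)
Unit-^ (0≤a , a≤1) j = ^-nonneg 0≤a j , ^≤1 0≤a a≤1 j

Unit-E : .{{_ : ℕ.NonZero n}} {f : Weight n} → UnitW f → Unit (E f)
Unit-E uf = E-nonneg (λ x → proj₁ (uf x)) , E-upper (λ x → proj₂ (uf x))

-- Each chosen vertex multiplies the weight by its adjacency row, so a single argument carries both
-- the vertex weights and the clique condition. For a graph and the indicator of a set this is the
-- number of labelled cliques in the set divided by n^j.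
K : (Fin n → Weight n) → ℕ → Weight n → ℚ
K A zero    f = 1ℚ
K A (suc j) f = E (λ x → f x * K A j (f ⊙ A x))

K-cong : (A : Fin n → Weight n) → ∀ j {f g : Weight n} → (∀ x → f x ≡ g x) → K A j f ≡ K A j g
K-cong A zero    f≗g = refl
K-cong A (suc j) f≗g = E-cong (λ x → cong₂ _*_ (f≗g x) (K-cong A j (λ y → cong (_* A x y) (f≗g y))))

K≤E^ : (A : Fin n → Weight n) → (∀ x → UnitW (A x)) → ∀ j {f : Weight n} → UnitW f → K A j f ≤ E f ^ℚ j
K≤E^ A uA zero    uf = ≤-refl
K≤E^ A uA (suc j) {f} uf = begin
  E (λ x → f x * K A j (f ⊙ A x)) ≤⟨ E-mono (λ x → *-monoˡ (f x) (proj₁ (uf x)) (begin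
      K A j (f ⊙ A x)   ≤⟨ K≤E^ A uA j (λ y → Unit-* (uf y) (uA x y)) ⟩
      E (f ⊙ A x) ^ℚ j  ≤⟨ ^-mono (E-nonneg (λ y → 0≤* (proj₁ (uf y)) (proj₁ (uA x y))))
                             (E-mono (λ y → *≤ˡ (proj₁ (uf y)) (proj₂ (uA x y)))) j ⟩
      E f ^ℚ j ∎)) ⟩
  E (λ x → f x * E f ^ℚ j)        ≡⟨ E-*ʳ (E f ^ℚ j) f ⟩
  E f * E f ^ℚ j ∎
  where open ≤-Reasoning

-- The binomial coefficient `j C 2`, in the form in which a new vertex adds its j edges to the
-- earlier ones; inductions along `K` then split the exponent by `^-+`.
tri : ℕ → ℕ
tri zero    = 0
tri (suc j) = tri j ℕ.+ j

-- Induction on the clique: after the choice of x the weight `f ⊙ A x` has mean close to q E f on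
-- average, and the j-th power turns this deviation into at most j β. These errors add up to `tri j`
-- times β. It serves twice: for the complete graph with q = 1, and for `A` with its own density.
counting : .{{_ : ℕ.NonZero n}} (A : Fin n → Weight n) → (∀ x → UnitW (A x)) → ∀ {q β} → Unit q →
  (∀ f → UnitW f → E (λ x → ∣ E (f ⊙ A x) - q * E f ∣) ≤ β) →
  ∀ j f → UnitW f → ∣ K A j f - q ^ℚ tri j * E f ^ℚ j ∣ ≤ ℕ→ℚ (tri j) * β
counting A uA {q} {β} uq reg zero    f uf = ≤-reflexive (sym (*-zeroˡ β))
counting {n} A uA {q} {β} uq reg (suc j) f uf = begin
  ∣ E (λ x → f x * k x) - q ^ℚ (tri j ℕ.+ j) * (E f * E f ^ℚ j) ∣ ≡⟨ cong (λ z → ∣ E (λ x → f x * k x) - z ∣) target ⟩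
  ∣ E (λ x → f x * k x) - E (λ x → f x * (c * e)) ∣      ≡⟨ cong ∣_∣ (sym (E-sub (λ x → f x * k x) (λ x → f x * (c * e)))) ⟩
  ∣ E (λ x → f x * k x - f x * (c * e)) ∣                ≤⟨ E-abs (λ x → f x * k x - f x * (c * e)) ⟩
  E (λ x → ∣ f x * k x - f x * (c * e) ∣)                ≤⟨ E-mono pointwise ⟩
  E (λ x → ℕ→ℚ (tri j) * β + ℕ→ℚ j * ∣ d x - q * E f ∣)  ≡⟨ E-+ (λ _ → ℕ→ℚ (tri j) * β) (λ x → ℕ→ℚ j * ∣ d x - q * E f ∣) ⟩
  E {n} (λ _ → ℕ→ℚ (tri j) * β) + E (λ x → ℕ→ℚ j * ∣ d x - q * E f ∣)
    ≡⟨ cong₂ _+_ (E-const (ℕ→ℚ (tri j) * β)) (E-* (ℕ→ℚ j) (λ x → ∣ d x - q * E f ∣)) ⟩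
  ℕ→ℚ (tri j) * β + ℕ→ℚ j * E (λ x → ∣ d x - q * E f ∣)  ≤⟨ +-monoʳ-≤ (ℕ→ℚ (tri j) * β) (*-monoˡ (ℕ→ℚ j) (ℕ→ℚ-nonneg j) (reg f uf)) ⟩
  ℕ→ℚ (tri j) * β + ℕ→ℚ j * β                            ≡⟨ sym (*-distribʳ-+ β (ℕ→ℚ (tri j)) (ℕ→ℚ j)) ⟩
  (ℕ→ℚ (tri j) + ℕ→ℚ j) * β                              ≡⟨ cong (_* β) (sym (ℕ→ℚ-+ (tri j) j)) ⟩
  ℕ→ℚ (tri j ℕ.+ j) * β ∎
  where
  open ≤-Reasoning
  k d : Weight n
  k x = K A j (f ⊙ A x)
  d x = E (f ⊙ A x)
  c = q ^ℚ tri j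
  e = (q * E f) ^ℚ j
  ufA : ∀ x → UnitW (f ⊙ A x)
  ufA x y = Unit-* (uf y) (uA x y)
  target : q ^ℚ (tri j ℕ.+ j) * (E f * E f ^ℚ j) ≡ E (λ x → f x * (c * e))
  target = trans (cong (_* (E f * E f ^ℚ j)) (^-+ q (tri j) j)) (trans
    (solve 4 (λ a b u v → a :* b :* (u :* v) := u :* (a :* (b :* v))) refl c (q ^ℚ j) (E f) (E f ^ℚ j))
    (trans (cong (λ z → E f * (c * z)) (sym (*-^ q (E f) j))) (sym (E-*ʳ (c * e) f))))
  pointwise : ∀ x → ∣ f x * k x - f x * (c * e) ∣ ≤ ℕ→ℚ (tri j) * β + ℕ→ℚ j * ∣ d x - q * E f ∣
  pointwise x = begin
    ∣ f x * k x - f x * (c * e) ∣ ≡⟨ cong ∣_∣ (solve 3 (λ a b c → a :* b :- a :* c := a :* (b :- c)) refl (f x) (k x) (c * e)) ⟩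
    ∣ f x * (k x - c * e) ∣       ≡⟨ ∣*∣ˡ (f x) (k x - c * e) (proj₁ (uf x)) ⟩
    f x * ∣ k x - c * e ∣         ≤⟨ *-monoʳ ∣ k x - c * e ∣ (0≤∣p∣ (k x - c * e)) (proj₂ (uf x)) ⟩
    1ℚ * ∣ k x - c * e ∣          ≡⟨ *-identityˡ ∣ k x - c * e ∣ ⟩
    ∣ k x - c * e ∣               ≤⟨ triangle (k x) (c * d x ^ℚ j) (c * e) ⟩
    ∣ k x - c * d x ^ℚ j ∣ + ∣ c * d x ^ℚ j - c * e ∣ ≤⟨ +-mono-≤ (counting A uA uq reg j (f ⊙ A x) (ufA x)) (begin
        ∣ c * d x ^ℚ j - c * e ∣   ≡⟨ cong ∣_∣ (solve 3 (λ a b c → a :* b :- a :* c := a :* (b :- c)) refl c (d x ^ℚ j) e) ⟩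
        ∣ c * (d x ^ℚ j - e) ∣     ≡⟨ ∣*∣ˡ c (d x ^ℚ j - e) (proj₁ (Unit-^ uq (tri j))) ⟩
        c * ∣ d x ^ℚ j - e ∣       ≤⟨ *-monoʳ ∣ d x ^ℚ j - e ∣ (0≤∣p∣ (d x ^ℚ j - e)) (proj₂ (Unit-^ uq (tri j))) ⟩
        1ℚ * ∣ d x ^ℚ j - e ∣      ≡⟨ *-identityˡ ∣ d x ^ℚ j - e ∣ ⟩
        ∣ d x ^ℚ j - e ∣           ≤⟨ ^-lipschitz (Unit-E (ufA x)) (Unit-* uq (Unit-E uf)) j ⟩
        ℕ→ℚ j * ∣ d x - q * E f ∣ ∎) ⟩
    ℕ→ℚ (tri j) * β + ℕ→ℚ j * ∣ d x - q * E f ∣ ∎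

-- Polarisation

E-zero : {f : Weight n} → (∀ x → f x ≡ 0ℚ) → E f ≡ 0ℚ
E-zero {f = f} f≗0 = trans (E-cong (λ x → trans (f≗0 x) (sym (*-zeroˡ (f x)))))
  (trans (E-* 0ℚ f) (*-zeroˡ (E f)))

-- Horner's scheme: the polynomial with the coefficients `c 0` up to `c (m - 1)`, hence of degree
-- below m.
eval : ℕ → (ℕ → ℚ) → ℚ → ℚ
eval zero    c s = 0ℚ
eval (suc m) c s = c 0 + s * eval m (c ∘ suc) s

eval-E : ∀ m (Γ : Fin n → ℕ → ℚ) s → eval m (λ i → E (λ x → Γ x i)) s ≡ E (λ x → eval m (Γ x) s)
eval-E {n} zero    Γ s = sym (E-zero {n} (λ _ → refl))
eval-E (suc m) Γ s = trans
  (cong (λ z → E (λ x → Γ x 0) + s * z) (eval-E m (λ x → Γ x ∘ suc) s))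
  (trans (cong (E (λ x → Γ x 0) +_) (sym (E-* s (λ x → eval m (Γ x ∘ suc) s))))
  (sym (E-+ (λ x → Γ x 0) (λ x → s * eval m (Γ x ∘ suc) s))))

eval-+ : ∀ m a b c d s → eval m (λ i → a * c i + b * d i) s ≡ a * eval m c s + b * eval m d s
eval-+ zero    a b c d s = solve 2 (λ a b → con 0ℚ := a :* con 0ℚ :+ b :* con 0ℚ) refl a b
eval-+ (suc m) a b c d s = trans
  (cong (λ z → a * c 0 + b * d 0 + s * z) (eval-+ m a b (c ∘ suc) (d ∘ suc) s))
  (solve 7 (λ a b c d s x y → a :* c :+ b :* d :+ s :* (a :* x :+ b :* y) := a :* (c :+ s :* x) :+ b :* (d :+ s :* y))
    refl a b (c 0) (d 0) s (eval m (c ∘ suc) s) (eval m (d ∘ suc) s))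

eval-zero : ∀ m {c : ℕ → ℚ} s → (∀ i → c i ≡ 0ℚ) → eval m c s ≡ 0ℚ
eval-zero zero    s c≗0 = refl
eval-zero (suc m) {c} s c≗0 = trans (cong₂ (λ a b → a + s * b) (c≗0 0) (eval-zero m s (c≗0 ∘ suc)))
  (solve 1 (λ s → con 0ℚ :+ s :* con 0ℚ := con 0ℚ) refl s)

2ℚ : ℚ
2ℚ = 1ℚ + 1ℚ

-- Halving the argument divides the coefficient of degree i by 2^i, so the factor 2^m cancels
-- exactly the top degree m. Only i < m is read on the right, where the truncated subtraction is an
-- honest one.
eval-eliminate : ∀ m c s → eval (suc m) c s - 2ℚ ^ℚ m * eval (suc m) c (½ * s)
                         ≡ eval m (λ i → (1ℚ - 2ℚ ^ℚ (m ℕ.∸ i)) * c i) s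
eval-eliminate zero    c s =
  solve 2 (λ a s → (a :+ s :* con 0ℚ) :- con 1ℚ :* (a :+ con ½ :* s :* con 0ℚ) := con 0ℚ) refl (c 0) s
eval-eliminate (suc m) c s = trans
  (solve 5 (λ a s u v w → (a :+ s :* u) :- con 2ℚ :* w :* (a :+ con ½ :* s :* v)
                        := (con 1ℚ :- con 2ℚ :* w) :* a :+ s :* (u :- w :* v)) refl
    (c 0) s (eval (suc m) (c ∘ suc) s) (eval (suc m) (c ∘ suc) (½ * s)) (2ℚ ^ℚ m))
  (cong (λ z → (1ℚ - 2ℚ ^ℚ suc m) * c 0 + s * z) (eval-eliminate m (c ∘ suc) s))

1≤2^ : ∀ m → 1ℚ ≤ 2ℚ ^ℚ m
1≤2^ zero    = ≤-refl
1≤2^ (suc m) = ≤-trans (1≤2^ m) (≤-diff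
  (solve 1 (λ x → con 2ℚ :* x :- x := x) refl (2ℚ ^ℚ m)) (≤-trans 0≤1 (1≤2^ m)))

-- `linConst d` belongs to polynomials of degree at most d + 1. The value 2 comes from the
-- difference of the values at 1 and 0 of a linear polynomial; removing degree d + 2 multiplies the
-- bound by 1 + 2^(d+2).
linConst : ℕ → ℚ
linConst zero    = 2ℚ
linConst (suc d) = linConst d * (1ℚ + 2ℚ ^ℚ suc (suc d))

linConst-nonneg : ∀ d → 0ℚ ≤ linConst d
linConst-nonneg zero    = nonNegative⁻¹ 2ℚ
linConst-nonneg (suc d) = 0≤* (linConst-nonneg d) (0≤+ 0≤1 (≤-trans 0≤1 (1≤2^ (suc (suc d)))))

Unit-½ : ∀ {s} → Unit s → Unit (½ * s)
Unit-½ us = Unit-* (nonNegative⁻¹ ½ , ≤-diff {½} {1ℚ} {½} refl (nonNegative⁻¹ ½)) us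

-- P(s) - 2^m P(s/2) has smaller degree than P, and its linear coefficient is not smaller in absolute value.
linear-coefficient-bound : ∀ d c {M} → (∀ s → Unit s → ∣ eval (suc (suc d)) c s ∣ ≤ M) → ∣ c 1 ∣ ≤ linConst d * M
linear-coefficient-bound zero c {M} bd = begin
  ∣ c 1 ∣                             ≡⟨ cong ∣_∣ (solve 2 (λ a b → b :=
                                           (a :+ con 1ℚ :* (b :+ con 1ℚ :* con 0ℚ)) :- (a :+ con 0ℚ :* (b :+ con 0ℚ :* con 0ℚ)))
                                           refl (c 0) (c 1)) ⟩
  ∣ eval 2 c 1ℚ - eval 2 c 0ℚ ∣       ≤⟨ ∣p-q∣≤∣p∣+∣q∣ (eval 2 c 1ℚ) (eval 2 c 0ℚ) ⟩
  ∣ eval 2 c 1ℚ ∣ + ∣ eval 2 c 0ℚ ∣   ≤⟨ +-mono-≤ (bd 1ℚ (0≤1 , ≤-refl)) (bd 0ℚ (≤-refl , 0≤1)) ⟩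
  M + M                               ≡⟨ solve 1 (λ m → m :+ m := con 2ℚ :* m) refl M ⟩
  2ℚ * M ∎
  where open ≤-Reasoning
linear-coefficient-bound (suc d) c {M} bd = begin
  ∣ c 1 ∣                             ≡⟨ sym (*-identityˡ ∣ c 1 ∣) ⟩
  1ℚ * ∣ c 1 ∣                        ≤⟨ *-monoʳ ∣ c 1 ∣ (0≤∣p∣ (c 1)) weight≥1 ⟩
  ∣ 1ℚ - 2ℚ ^ℚ suc d ∣ * ∣ c 1 ∣      ≡⟨ sym (∣p*q∣≡∣p∣*∣q∣ (1ℚ - 2ℚ ^ℚ suc d) (c 1)) ⟩
  ∣ (1ℚ - 2ℚ ^ℚ suc d) * c 1 ∣        ≤⟨ linear-coefficient-bound d (λ i → (1ℚ - 2ℚ ^ℚ (m ℕ.∸ i)) * c i) bd′ ⟩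
  linConst d * ((1ℚ + 2ℚ ^ℚ m) * M)   ≡⟨ sym (*-assoc (linConst d) (1ℚ + 2ℚ ^ℚ m) M) ⟩
  linConst (suc d) * M ∎
  where
  open ≤-Reasoning
  m = suc (suc d)
  weight≥1 : 1ℚ ≤ ∣ 1ℚ - 2ℚ ^ℚ suc d ∣
  weight≥1 = ≤-trans (≤-diff (solve 1 (λ x → (:- (con 1ℚ :- con 2ℚ :* x)) :- con 1ℚ := con 2ℚ :* (x :- con 1ℚ)) refl (2ℚ ^ℚ d))
    (0≤* (nonNegative⁻¹ 2ℚ) (0≤d (1≤2^ d)))) (-x≤∣x∣ (1ℚ - 2ℚ ^ℚ suc d))
  bd′ : ∀ s → Unit s → ∣ eval m (λ i → (1ℚ - 2ℚ ^ℚ (m ℕ.∸ i)) * c i) s ∣ ≤ (1ℚ + 2ℚ ^ℚ m) * M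
  bd′ s us = begin
    ∣ eval m (λ i → (1ℚ - 2ℚ ^ℚ (m ℕ.∸ i)) * c i) s ∣ ≡⟨ cong ∣_∣ (sym (eval-eliminate m c s)) ⟩
    ∣ u - 2ℚ ^ℚ m * v ∣          ≤⟨ ∣p-q∣≤∣p∣+∣q∣ u (2ℚ ^ℚ m * v) ⟩
    ∣ u ∣ + ∣ 2ℚ ^ℚ m * v ∣      ≡⟨ cong (∣ u ∣ +_) (∣*∣ˡ (2ℚ ^ℚ m) v (≤-trans 0≤1 (1≤2^ m))) ⟩
    ∣ u ∣ + 2ℚ ^ℚ m * ∣ v ∣      ≤⟨ +-mono-≤ (bd s us) (*-monoˡ (2ℚ ^ℚ m) (≤-trans 0≤1 (1≤2^ m)) (bd (½ * s) (Unit-½ us))) ⟩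
    M + 2ℚ ^ℚ m * M              ≡⟨ solve 2 (λ a m → m :+ a :* m := (con 1ℚ :+ a) :* m) refl (2ℚ ^ℚ m) M ⟩
    (1ℚ + 2ℚ ^ℚ m) * M ∎
    where
    u = eval (suc m) c s
    v = eval (suc m) c (½ * s)

-- Expansion of clique densities along a line of weights

record Adjacency (A : Fin n → Weight n) : Set where
  field
    symmetric : ∀ x y → A x y ≡ A y x
    loopless  : ∀ x → A x x ≡ 0ℚ
    unit      : ∀ x → UnitW (A x)
open Adjacency public

shift : (ℕ → ℚ) → ℕ → ℚ
shift c zero    = 0ℚ
shift c (suc i) = c i

-- coeff A j f h i is the coefficient of s^i in K A j (f + s h).
coeff : (Fin n → Weight n) → ℕ → Weight n → Weight n → ℕ → ℚ
coeff A zero    f h zero    = 1ℚ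
coeff A zero    f h (suc i) = 0ℚ
coeff A (suc j) f h i = E (λ x → f x * coeff A j (f ⊙ A x) (h ⊙ A x) i + h x * shift (coeff A j (f ⊙ A x) (h ⊙ A x)) i)

-- The length m is left free above the degree j because the induction needs two lengths: the summand
-- with h x carries an extra factor s, so its polynomial is read one term shorter than the summand
-- with f x.
K-expand : (A : Fin n → Weight n) → ∀ j f h s m → j ℕ.< m →
  K A j (λ x → f x + s * h x) ≡ eval m (coeff A j f h) s
K-expand A zero f h s (suc m) _ = trans
  (solve 1 (λ s → con 1ℚ := con 1ℚ :+ s :* con 0ℚ) refl s)
  (cong (λ z → 1ℚ + s * z) (sym (eval-zero m s (λ _ → refl))))
K-expand {n} A (suc j) f h s (suc m) (ℕ.s≤s j<m) = trans (E-cong pointwise) (sym (eval-E (suc m) Γ s))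
  where
  open ≡-Reasoning
  c : Fin n → ℕ → ℚ
  c x = coeff A j (f ⊙ A x) (h ⊙ A x)
  Γ : Fin n → ℕ → ℚ
  Γ x i = f x * c x i + h x * shift (c x) i
  pointwise : ∀ x → (f x + s * h x) * K A j ((λ y → f y + s * h y) ⊙ A x) ≡ eval (suc m) (Γ x) s
  pointwise x = begin
    (f x + s * h x) * K A j ((λ y → f y + s * h y) ⊙ A x)
      ≡⟨ cong ((f x + s * h x) *_) (K-cong A j (λ y → solve 4 (λ f s h a → (f :+ s :* h) :* a := f :* a :+ s :* (h :* a)) refl (f y) s (h y) (A x y))) ⟩
    (f x + s * h x) * v
      ≡⟨ solve 4 (λ f s h v → (f :+ s :* h) :* v := f :* v :+ h :* (con 0ℚ :+ s :* v)) refl (f x) s (h x) v ⟩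
    f x * v + h x * (0ℚ + s * v)
      ≡⟨ cong₂ (λ a b → f x * a + h x * (0ℚ + s * b)) (K-expand A j (f ⊙ A x) (h ⊙ A x) s (suc m) (ℕₚ.m<n⇒m<1+n j<m))
           (K-expand A j (f ⊙ A x) (h ⊙ A x) s m j<m) ⟩
    f x * eval (suc m) (c x) s + h x * eval (suc m) (shift (c x)) s
      ≡⟨ sym (eval-+ (suc m) (f x) (h x) (c x) (shift (c x)) s) ⟩
    eval (suc m) (Γ x) s ∎
    where v = K A j (λ y → (f ⊙ A x) y + s * (h ⊙ A x) y)

coeff-0 : (A : Fin n → Weight n) → ∀ j f h → coeff A j f h 0 ≡ K A j f
coeff-0 A zero    f h = refl
coeff-0 A (suc j) f h = E-cong λ x → trans
  (solve 3 (λ f c h → f :* c :+ h :* con 0ℚ := f :* c) refl (f x) (coeff A j (f ⊙ A x) (h ⊙ A x) 0) (h x))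
  (cong (f x *_) (coeff-0 A j (f ⊙ A x) (h ⊙ A x)))

-- The linear term has one `h` at one of the `suc j` clique vertices. Symmetry of `A` and exchange
-- of averages bring that vertex to the front, so all positions contribute the same amount.
coeff-1 : (A : Fin n → Weight n) → Adjacency A → ∀ j f h →
  coeff A (suc j) f h 1 ≡ ℕ→ℚ (suc j) * E (λ x → h x * K A j (f ⊙ A x))
coeff-1 A adj zero f h = trans
  (E-cong (λ x → solve 2 (λ f h → f :* con 0ℚ :+ h :* con 1ℚ := h :* con 1ℚ) refl (f x) (h x)))
  (sym (*-identityˡ (E (λ x → h x * 1ℚ))))
coeff-1 {n} A adj (suc j) f h = begin
  E (λ x → f x * coeff A (suc j) (f ⊙ A x) (h ⊙ A x) 1 + h x * coeff A (suc j) (f ⊙ A x) (h ⊙ A x) 0)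
    ≡⟨ E-+ (λ x → f x * coeff A (suc j) (f ⊙ A x) (h ⊙ A x) 1) (λ x → h x * coeff A (suc j) (f ⊙ A x) (h ⊙ A x) 0) ⟩
  E (λ x → f x * coeff A (suc j) (f ⊙ A x) (h ⊙ A x) 1) + E (λ x → h x * coeff A (suc j) (f ⊙ A x) (h ⊙ A x) 0)
    ≡⟨ cong₂ _+_ first (E-cong (λ x → cong (h x *_) (coeff-0 A (suc j) (f ⊙ A x) (h ⊙ A x)))) ⟩
  ι * total + total
    ≡⟨ solve 2 (λ j t → j :* t :+ t := (con 1ℚ :+ j) :* t) refl ι total ⟩
  (1ℚ + ι) * total
    ≡⟨ cong (_* total) (sym (ℕ→ℚ-suc (suc j))) ⟩
  ℕ→ℚ (suc (suc j)) * total ∎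
  where
  open ≡-Reasoning
  ι = ℕ→ℚ (suc j)
  total = E (λ x → h x * K A (suc j) (f ⊙ A x))
  Θ : Fin n → Fin n → ℚ
  Θ x y = f x * ((h y * A x y) * K A j (f ⊙ A x ⊙ A y))
  Θ′ : ∀ x y → Θ x y ≡ h y * ((f x * A y x) * K A j (f ⊙ A y ⊙ A x))
  Θ′ x y = trans (cong₂ (λ a k → f x * ((h y * a) * k)) (symmetric adj x y)
      (K-cong A j (λ z → solve 3 (λ f a b → f :* a :* b := f :* b :* a) refl (f z) (A x z) (A y z))))
    (solve 4 (λ f h a k → f :* ((h :* a) :* k) := h :* ((f :* a) :* k)) refl (f x) (h y) (A y x) (K A j (f ⊙ A y ⊙ A x)))
  first : E (λ x → f x * coeff A (suc j) (f ⊙ A x) (h ⊙ A x) 1) ≡ ι * total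
  first = begin
    E (λ x → f x * coeff A (suc j) (f ⊙ A x) (h ⊙ A x) 1)
      ≡⟨ E-cong (λ x → trans (cong (f x *_) (coeff-1 A adj j (f ⊙ A x) (h ⊙ A x)))
           (solve 3 (λ f j e → f :* (j :* e) := j :* (f :* e)) refl (f x) ι (E (λ y → (h y * A x y) * K A j (f ⊙ A x ⊙ A y))))) ⟩
    E (λ x → ι * (f x * E (λ y → (h y * A x y) * K A j (f ⊙ A x ⊙ A y))))
      ≡⟨ E-* ι (λ x → f x * E (λ y → (h y * A x y) * K A j (f ⊙ A x ⊙ A y))) ⟩
    ι * E (λ x → f x * E (λ y → (h y * A x y) * K A j (f ⊙ A x ⊙ A y)))
      ≡⟨ cong (ι *_) (E-cong (λ x → sym (E-* (f x) (λ y → (h y * A x y) * K A j (f ⊙ A x ⊙ A y))))) ⟩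
    ι * E (λ x → E (Θ x))
      ≡⟨ cong (ι *_) (trans (E-swap Θ) (E-cong (λ y → trans (E-cong (λ x → Θ′ x y))
           (E-* (h y) (λ x → (f x * A y x) * K A j (f ⊙ A y ⊙ A x)))))) ⟩
    ι * total ∎

-- Every coefficient of positive degree contains some value of `h` as a factor.
coeff-annihilated : (A : Fin n → Weight n) → ∀ a j f h i → (∀ y → a * h y ≡ 0ℚ) → a * coeff A j f h (suc i) ≡ 0ℚ
coeff-annihilated A a zero    f h i ah≡0 = *-zeroʳ a
coeff-annihilated A a (suc j) f h i ah≡0 = trans (sym (E-* a (λ x → f x * coeff A j (f ⊙ A x) (h ⊙ A x) (suc i) + h x * coeff A j (f ⊙ A x) (h ⊙ A x) i))) (E-zero λ x → trans
  (solve 5 (λ a f c h d → a :* (f :* c :+ h :* d) := f :* (a :* c) :+ a :* h :* d) refl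
    a (f x) (coeff A j (f ⊙ A x) (h ⊙ A x) (suc i)) (h x) (coeff A j (f ⊙ A x) (h ⊙ A x) i))
  (trans (cong₂ (λ u v → f x * u + v * coeff A j (f ⊙ A x) (h ⊙ A x) i)
      (coeff-annihilated A a j (f ⊙ A x) (h ⊙ A x) i (λ y → trans (sym (*-assoc a (h y) (A x y)))
        (trans (cong (_* A x y) (ah≡0 y)) (*-zeroˡ (A x y)))))
      (ah≡0 x))
    (solve 2 (λ f d → f :* con 0ℚ :+ con 0ℚ :* d := con 0ℚ) refl (f x) (coeff A j (f ⊙ A x) (h ⊙ A x) i))))

-- The hypothesis says that the support of `h` is independent. A clique meets it at most once, so no
-- term carries two factors of `h`.
coeff-independent : (A : Fin n → Weight n) → ∀ j f h i → (∀ x y → h x * (h y * A x y) ≡ 0ℚ) →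
  coeff A j f h (suc (suc i)) ≡ 0ℚ
coeff-independent A zero    f h i ind = refl
coeff-independent A (suc j) f h i ind = E-zero λ x → trans
  (cong₂ (λ u v → f x * u + v)
    (coeff-independent A j (f ⊙ A x) (h ⊙ A x) i (λ y z → trans
      (solve 5 (λ hy hz a b c → hy :* b :* (hz :* c :* a) := hy :* (hz :* a) :* (b :* c)) refl (h y) (h z) (A y z) (A x y) (A x z))
      (trans (cong (_* (A x y * A x z)) (ind y z)) (*-zeroˡ (A x y * A x z)))))
    (coeff-annihilated A (h x) j (f ⊙ A x) (h ⊙ A x) i (ind x)))
  (solve 1 (λ f → f :* con 0ℚ :+ con 0ℚ := con 0ℚ) refl (f x))

K-affine : (A : Fin n → Weight n) → ∀ j f h s → (∀ x y → h x * (h y * A x y) ≡ 0ℚ) →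
  K A j (λ x → f x + s * h x) ≡ K A j f + s * coeff A j f h 1
K-affine A j f h s ind = begin
  K A j (λ x → f x + s * h x)                  ≡⟨ K-expand A j f h s (suc (suc j)) (ℕₚ.m<n⇒m<1+n (ℕₚ.n<1+n j)) ⟩
  c 0 + s * (c 1 + s * eval j (λ i → c (suc (suc i))) s) ≡⟨ cong₂ (λ a b → a + s * (c 1 + s * b)) (coeff-0 A j f h)
                                                    (eval-zero j s (λ i → coeff-independent A j f h i ind)) ⟩
  K A j f + s * (c 1 + s * 0ℚ)                 ≡⟨ solve 3 (λ k s c → k :+ s :* (c :+ s :* con 0ℚ) := k :+ s :* c) refl (K A j f) s (c 1) ⟩
  K A j f + s * c 1 ∎
  where
  open ≡-Reasoning
  c = coeff A j f h

-- From vertex sets to weights by coordinatewise affinity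

bit : Bool → ℚ
bit b = if b then 1ℚ else 0ℚ

indicator : Subset n → Weight n
indicator S x = bit (lookup S x)

atom : Fin n → Weight n
atom x y = bit (does (x ≟ y))

CoordinatewiseAffine : (Weight n → ℚ) → Set
CoordinatewiseAffine Φ = ∀ v f → Σ ℚ λ b → ∀ s → Φ (λ x → f x + s * atom v x) ≡ Φ f + s * b

convex-bound : ∀ u b s {M} → ∣ u ∣ ≤ M → ∣ u + 1ℚ * b ∣ ≤ M → Unit s → ∣ u + s * b ∣ ≤ M
convex-bound u b s {M} bd₀ bd₁ (0≤s , s≤1) = begin
  ∣ u + s * b ∣ ≡⟨ cong ∣_∣ (solve 3 (λ u b s → u :+ s :* b := (con 1ℚ :- s) :* u :+ s :* (u :+ con 1ℚ :* b)) refl u b s) ⟩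
  ∣ (1ℚ - s) * u + s * (u + 1ℚ * b) ∣       ≤⟨ ∣p+q∣≤∣p∣+∣q∣ ((1ℚ - s) * u) (s * (u + 1ℚ * b)) ⟩
  ∣ (1ℚ - s) * u ∣ + ∣ s * (u + 1ℚ * b) ∣   ≡⟨ cong₂ _+_ (∣*∣ˡ (1ℚ - s) u (0≤d s≤1)) (∣*∣ˡ s (u + 1ℚ * b) 0≤s) ⟩
  (1ℚ - s) * ∣ u ∣ + s * ∣ u + 1ℚ * b ∣     ≤⟨ +-mono-≤ (*-monoˡ (1ℚ - s) (0≤d s≤1) bd₀) (*-monoˡ s 0≤s bd₁) ⟩
  (1ℚ - s) * M + s * M                      ≡⟨ solve 2 (λ s m → (con 1ℚ :- s) :* m :+ s :* m := m) refl s M ⟩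
  M ∎
  where open ≤-Reasoning

-- Along one coordinate the value is a convex combination of the values on the faces 0 and 1.
-- Treating the coordinates in turn reduces the cube to its vertices, which are the indicators of
-- sets.
vertex-bound : ∀ n (Φ : Weight n → ℚ) {M} → (∀ {f g} → (∀ x → f x ≡ g x) → Φ f ≡ Φ g) → CoordinatewiseAffine Φ →
  (∀ S → ∣ Φ (indicator S) ∣ ≤ M) → ∀ f → UnitW f → ∣ Φ f ∣ ≤ M
vertex-bound zero    Φ {M} Φ-cong aff bd f uf = subst (λ z → ∣ z ∣ ≤ M) (Φ-cong (λ ())) (bd [])
vertex-bound (suc n) Φ {M} Φ-cong aff bd f uf =
  subst (λ z → ∣ z ∣ ≤ M) (trans (sym (at (f zero))) (Φ-cong λ { zero → refl ; (suc x) → refl }))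
    (convex-bound (Φ (0ℚ F.∷ f ∘ suc)) b (f zero) (face false)
      (subst (λ z → ∣ z ∣ ≤ M) (at 1ℚ) (face true)) (uf zero))
  where
  b = proj₁ (aff zero (0ℚ F.∷ f ∘ suc))
  at : ∀ s → Φ (s F.∷ f ∘ suc) ≡ Φ (0ℚ F.∷ f ∘ suc) + s * b
  at s = trans (Φ-cong λ { zero    → solve 1 (λ s → s := con 0ℚ :+ s :* con 1ℚ) refl s
                         ; (suc x) → solve 2 (λ s f → f := f :+ s :* con 0ℚ) refl s (f (suc x)) })
    (proj₂ (aff zero (0ℚ F.∷ f ∘ suc)) s)
  face : ∀ c → ∣ Φ (bit c F.∷ f ∘ suc) ∣ ≤ M
  face c = vertex-bound n (λ g → Φ (bit c F.∷ g))
    (λ g≗h → Φ-cong λ { zero → refl ; (suc x) → g≗h x })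
    (λ v g → proj₁ (aff (suc v) (bit c F.∷ g)) , λ s → trans
      (Φ-cong λ { zero    → solve 2 (λ c s → c := c :+ s :* con 0ℚ) refl (bit c) s
                ; (suc x) → refl })
      (proj₂ (aff (suc v) (bit c F.∷ g)) s))
    (λ S → subst (λ z → ∣ z ∣ ≤ M) (Φ-cong λ { zero → refl ; (suc x) → refl }) (bd (c ∷ S)))
    (f ∘ suc) (λ x → uf (suc x))

atom-refl : (x : Fin n) → atom x x ≡ 1ℚ
atom-refl x with x ≟ x
... | yes _  = refl
... | no x≢x = contradiction refl x≢x

atom-sym : (x y : Fin n) → atom x y ≡ atom y x
atom-sym x y with x ≟ y | y ≟ x
... | yes _   | yes _   = refl
... | no _    | no _    = refl
... | yes x≡y | no y≢x  = contradiction (sym x≡y) y≢x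
... | no x≢y  | yes y≡x = contradiction (sym y≡x) x≢y

atom-unit : (x : Fin n) → UnitW (atom x)
atom-unit x y with x ≟ y
... | yes _ = 0≤1 , ≤-refl
... | no _  = ≤-refl , 0≤1

sum-atom : (x : Fin n) → sum (atom x) ≡ 1ℚ
sum-atom {suc n} zero    = cong (1ℚ +_) (trans (sum-const n 0ℚ) (*-zeroʳ (ℕ→ℚ n)))
sum-atom {suc n} (suc x) = trans (cong (0ℚ +_) (sum-atom x)) (+-identityˡ 1ℚ)

atom-independent : {A : Fin n → Weight n} → Adjacency A → ∀ v x y → atom v x * (atom v y * A x y) ≡ 0ℚ
atom-independent {A = A} adj v x y with v ≟ x | v ≟ y
... | yes refl | yes refl = cong (λ z → 1ℚ * (1ℚ * z)) (loopless adj v)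
... | no _     | d        = *-zeroˡ (bit (does d) * A x y)
... | yes _    | no _     = cong (1ℚ *_) (*-zeroˡ (A x y))

-- The complete graph as reference

complete : Fin n → Weight n
complete x y = 1ℚ - atom x y

complete-adjacency : Adjacency (complete {n})
complete-adjacency = record
  { symmetric = λ x y → cong (λ z → 1ℚ - z) (atom-sym x y)
  ; loopless  = λ x → cong (λ z → 1ℚ - z) (atom-refl x)
  ; unit      = λ x y → 0≤d (proj₂ (atom-unit x y)) ,
      ≤-diff (solve 1 (λ d → con 1ℚ :- (con 1ℚ :- d) := d) refl (atom x y)) (proj₁ (atom-unit x y))
  }

-- The two averages differ only in the term at y = x, whose share is at most 1/n.
complete-regular : (f : Weight n) → UnitW f → ∀ x → ∣ E (f ⊙ complete x) - 1ℚ * E f ∣ ≤ recip n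
complete-regular {n} f uf x = begin
  ∣ E (f ⊙ complete x) - 1ℚ * E f ∣       ≡⟨ cong (λ z → ∣ E (f ⊙ complete x) - z ∣) (*-identityˡ (E f)) ⟩
  ∣ E (f ⊙ complete x) - E f ∣            ≡⟨ cong ∣_∣ (sym (E-sub (f ⊙ complete x) f)) ⟩
  ∣ E (λ y → f y * complete x y - f y) ∣  ≤⟨ E-abs (λ y → f y * complete x y - f y) ⟩
  E (λ y → ∣ f y * complete x y - f y ∣)  ≤⟨ E-mono (λ y → begin
      ∣ f y * complete x y - f y ∣        ≡⟨ cong ∣_∣ (solve 2 (λ f d → f :* (con 1ℚ :- d) :- f := :- (f :* d)) refl (f y) (atom x y)) ⟩
      ∣ - (f y * atom x y) ∣                 ≡⟨ ∣-p∣≡∣p∣ (f y * atom x y) ⟩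
      ∣ f y * atom x y ∣                     ≡⟨ 0≤p⇒∣p∣≡p (0≤* (proj₁ (uf y)) (proj₁ (atom-unit x y))) ⟩
      f y * atom x y                         ≤⟨ *-monoʳ (atom x y) (proj₁ (atom-unit x y)) (proj₂ (uf y)) ⟩
      1ℚ * atom x y                          ≡⟨ *-identityˡ (atom x y) ⟩
      atom x y ∎) ⟩
  E (atom x)                                 ≡⟨ cong (recip n *_) (sum-atom x) ⟩
  recip n * 1ℚ                            ≡⟨ *-identityʳ (recip n) ⟩
  recip n ∎
  where open ≤-Reasoning

1^ : ∀ j → 1ℚ ^ℚ j ≡ 1ℚ
1^ zero    = refl
1^ (suc j) = trans (*-identityˡ (1ℚ ^ℚ j)) (1^ j)

K-complete : .{{_ : ℕ.NonZero n}} → ∀ j (f : Weight n) → UnitW f →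
  ∣ K complete j f - E f ^ℚ j ∣ ≤ ℕ→ℚ (tri j) * recip n
K-complete {n} j f uf = subst (λ z → ∣ K complete j f - z ∣ ≤ ℕ→ℚ (tri j) * recip n)
  (trans (cong (_* E f ^ℚ j) (1^ (tri j))) (*-identityˡ (E f ^ℚ j)))
  (counting complete (unit complete-adjacency) (0≤1 , ≤-refl)
    (λ g ug → E-upper (complete-regular g ug)) j f uf)

-- Comparing with K complete instead of E f ^ j makes the discrepancy affine in each coordinate of f.
excess : (Fin n → Weight n) → ℚ → ℕ → Weight n → ℚ
excess A P j f = K A j f - P * K complete j f

excess-vertex-bound : {A : Fin n → Weight n} → Adjacency A → ∀ P j {M} →
  (∀ S → ∣ excess A P j (indicator S) ∣ ≤ M) → ∀ f → UnitW f → ∣ excess A P j f ∣ ≤ M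
excess-vertex-bound {n} {A} adj P j bd = vertex-bound n (excess A P j)
  (λ f≗g → cong₂ (λ a b → a - P * b) (K-cong A j f≗g) (K-cong complete j f≗g))
  (λ v f → coeff A j f (atom v) 1 - P * coeff complete j f (atom v) 1 , λ s → trans
    (cong₂ (λ a b → a - P * b) (K-affine A j f (atom v) s (atom-independent adj v))
      (K-affine complete j f (atom v) s (atom-independent complete-adjacency v)))
    (solve 6 (λ a b c d p s → a :+ s :* b :- p :* (c :+ s :* d) := a :- p :* c :+ s :* (b :- p :* d)) refl
      (K A j f) (coeff A j f (atom v) 1) (K complete j f) (coeff complete j f (atom v) 1) P s))
  bd

-- Directional derivative and rooted clique counts

HalfW : Weight n → Set
HalfW f = ∀ x → 0ℚ ≤ f x × f x ≤ ½

½≤1 : ½ ≤ 1ℚ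
½≤1 = ≤-diff {½} {1ℚ} {½} refl (nonNegative⁻¹ ½)

HalfW⇒UnitW : {f : Weight n} → HalfW f → UnitW f
HalfW⇒UnitW hf x = proj₁ (hf x) , ≤-trans (proj₂ (hf x)) ½≤1

-- The average on the left is, up to the factor `suc k`, the linear coefficient of s ↦ excess at f +
-- s h. Both weights are at most 1/2, so the path stays among unit weights for s in [0,1] and the
-- coefficient bound applies.
excess-derivative : {A : Fin n → Weight n} → Adjacency A → ∀ P k {M} →
  (∀ f → UnitW f → ∣ excess A P (suc k) f ∣ ≤ M) → ∀ f h → HalfW f → HalfW h →
  ∣ E (λ x → h x * (K A k (f ⊙ A x) - P * K complete k (f ⊙ complete x))) ∣ ≤ linConst k * M
excess-derivative {n} {A} adj P k {M} bd f h hf hh = begin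
  ∣ D ∣                  ≡⟨ sym (*-identityˡ ∣ D ∣) ⟩
  1ℚ * ∣ D ∣             ≤⟨ *-monoʳ ∣ D ∣ (0≤∣p∣ D) (ℕ→ℚ-mono {1} {suc k} (ℕ.s≤s ℕ.z≤n)) ⟩
  ℕ→ℚ (suc k) * ∣ D ∣    ≡⟨ sym (∣*∣ˡ (ℕ→ℚ (suc k)) D (ℕ→ℚ-nonneg (suc k))) ⟩
  ∣ ℕ→ℚ (suc k) * D ∣    ≡⟨ cong ∣_∣ (sym c1≡) ⟩
  ∣ c 1 ∣                ≤⟨ linear-coefficient-bound k c bd′ ⟩
  linConst k * M ∎
  where
  open ≤-Reasoning
  a b : Weight n
  a x = K A k (f ⊙ A x)
  b x = K complete k (f ⊙ complete x)
  D = E (λ x → h x * (a x - P * b x))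
  c : ℕ → ℚ
  c i = 1ℚ * coeff A (suc k) f h i + (- P) * coeff complete (suc k) f h i
  split : D ≡ E (λ x → h x * a x) - P * E (λ x → h x * b x)
  split = trans (E-cong (λ x → solve 4 (λ h a p b → h :* (a :- p :* b) := h :* a :- p :* (h :* b)) refl (h x) (a x) P (b x)))
    (trans (E-sub (λ x → h x * a x) (λ x → P * (h x * b x)))
      (cong (λ z → E (λ x → h x * a x) - z) (E-* P (λ x → h x * b x))))
  c1≡ : c 1 ≡ ℕ→ℚ (suc k) * D
  c1≡ = trans (cong₂ (λ u v → 1ℚ * u + (- P) * v) (coeff-1 A adj k f h) (coeff-1 complete complete-adjacency k f h))
    (trans (solve 4 (λ m u v p → con 1ℚ :* (m :* u) :+ (:- p) :* (m :* v) := m :* (u :- p :* v)) refl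
        (ℕ→ℚ (suc k)) (E (λ x → h x * a x)) (E (λ x → h x * b x)) P)
      (cong (ℕ→ℚ (suc k) *_) (sym split)))
  bd′ : ∀ s → Unit s → ∣ eval (suc (suc k)) c s ∣ ≤ M
  bd′ s (0≤s , s≤1) = ≤-trans (≤-reflexive (cong ∣_∣ (trans
      (eval-+ (suc (suc k)) 1ℚ (- P) (coeff A (suc k) f h) (coeff complete (suc k) f h) s)
      (trans (cong₂ (λ u v → 1ℚ * u + (- P) * v)
          (sym (K-expand A (suc k) f h s (suc (suc k)) (ℕₚ.n<1+n (suc k))))
          (sym (K-expand complete (suc k) f h s (suc (suc k)) (ℕₚ.n<1+n (suc k)))))
        (solve 3 (λ u v p → con 1ℚ :* u :+ (:- p) :* v := u :- p :* v) refl
          (K A (suc k) g) (K complete (suc k) g) P)))))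
    (bd g (λ x → 0≤+ (proj₁ (hf x)) (0≤* 0≤s (proj₁ (hh x))) ,
      +-mono-≤ (proj₂ (hf x)) (≤-trans (*-mono 0≤s s≤1 (proj₁ (hh x)) (proj₂ (hh x))) (≤-reflexive (*-identityˡ ½)))))
    where
    g : Weight n
    g x = f x + s * h x

4ℚ : ℚ
4ℚ = 2ℚ + 2ℚ

-- Test against one half of the indicator of each sign of φ. The 4 is a factor 2 for the halves and
-- a factor 2 for the two signs.
l1-duality : (φ : Weight n) → ∀ {B} → (∀ h → HalfW h → ∣ E (λ x → h x * φ x) ∣ ≤ B) → E (λ x → ∣ φ x ∣) ≤ 4ℚ * B
l1-duality {n} φ {B} bd = begin
  E (λ x → ∣ φ x ∣)                                  ≡⟨ E-cong (λ x → signs (φ x)) ⟩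
  E (λ x → 2ℚ * (h⁺ x * φ x) - 2ℚ * (h⁻ x * φ x))    ≡⟨ E-sub (λ x → 2ℚ * (h⁺ x * φ x)) (λ x → 2ℚ * (h⁻ x * φ x)) ⟩
  E (λ x → 2ℚ * (h⁺ x * φ x)) - E (λ x → 2ℚ * (h⁻ x * φ x))
    ≡⟨ cong₂ _-_ (E-* 2ℚ (λ x → h⁺ x * φ x)) (E-* 2ℚ (λ x → h⁻ x * φ x)) ⟩
  2ℚ * u - 2ℚ * v                                    ≡⟨ solve 2 (λ u v → con 2ℚ :* u :- con 2ℚ :* v := con 2ℚ :* (u :- v)) refl u v ⟩
  2ℚ * (u - v)                                       ≤⟨ *-monoˡ 2ℚ (nonNegative⁻¹ 2ℚ) (≤-trans (x≤∣x∣ (u - v)) (≤-trans (∣p-q∣≤∣p∣+∣q∣ u v)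
                                                          (+-mono-≤ (bd h⁺ half⁺) (bd h⁻ half⁻)))) ⟩
  2ℚ * (B + B)                                       ≡⟨ solve 1 (λ b → con 2ℚ :* (b :+ b) := con 4ℚ :* b) refl B ⟩
  4ℚ * B ∎
  where
  open ≤-Reasoning
  plus minus : ℚ → ℚ
  plus y with ≤-total 0ℚ y
  ... | inj₁ _ = ½
  ... | inj₂ _ = 0ℚ
  minus y with ≤-total 0ℚ y
  ... | inj₁ _ = 0ℚ
  ... | inj₂ _ = ½
  h⁺ h⁻ : Weight n
  h⁺ x = plus (φ x)
  h⁻ x = minus (φ x)
  half⁺ : HalfW h⁺
  half⁺ x with ≤-total 0ℚ (φ x)
  ... | inj₁ _ = nonNegative⁻¹ ½ , ≤-refl
  ... | inj₂ _ = ≤-refl , nonNegative⁻¹ ½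
  half⁻ : HalfW h⁻
  half⁻ x with ≤-total 0ℚ (φ x)
  ... | inj₂ _ = nonNegative⁻¹ ½ , ≤-refl
  ... | inj₁ _ = ≤-refl , nonNegative⁻¹ ½
  signs : ∀ y → ∣ y ∣ ≡ 2ℚ * (plus y * y) - 2ℚ * (minus y * y)
  signs y with ≤-total 0ℚ y
  ... | inj₁ 0≤y = trans (0≤p⇒∣p∣≡p 0≤y)
    (solve 1 (λ y → y := con 2ℚ :* (con ½ :* y) :- con 2ℚ :* (con 0ℚ :* y)) refl y)
  ... | inj₂ y≤0 = trans (trans (sym (∣-p∣≡∣p∣ y)) (0≤p⇒∣p∣≡p (neg-antimono-≤ y≤0)))
    (solve 1 (λ y → :- y := con 2ℚ :* (con 0ℚ :* y) :- con 2ℚ :* (con ½ :* y)) refl y)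
  u = E (λ x → h⁺ x * φ x)
  v = E (λ x → h⁻ x * φ x)

-- The derivative of the excess has the complete-graph density of k-cliques avoiding x as its main
-- term. Replacing it by the power of E f costs tri k / n for repeated vertices and k / n for the
-- removal of x, together `tri (suc k)` / n.
rooted-count : .{{_ : ℕ.NonZero n}} → {A : Fin n → Weight n} → Adjacency A → ∀ {P} → Unit P → ∀ k {M} →
  (∀ S → ∣ excess A P (suc k) (indicator S) ∣ ≤ M) → ∀ f → HalfW f →
  E (λ x → ∣ K A k (f ⊙ A x) - P * E f ^ℚ k ∣) ≤ 4ℚ * (linConst k * M) + ℕ→ℚ (tri (suc k)) * recip n
rooted-count {n} {A} adj {P} uP k {M} bd f hf = begin
  E (λ x → ∣ K A k (f ⊙ A x) - P * E f ^ℚ k ∣)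
    ≤⟨ E-mono pointwise ⟩
  E (λ x → ∣ φ x ∣ + ℕ→ℚ (tri (suc k)) * recip n)
    ≡⟨ E-+ (λ x → ∣ φ x ∣) (λ _ → ℕ→ℚ (tri (suc k)) * recip n) ⟩
  E (λ x → ∣ φ x ∣) + E {n} (λ _ → ℕ→ℚ (tri (suc k)) * recip n)
    ≤⟨ +-mono-≤ (l1-duality φ (λ h hh → excess-derivative adj P k (excess-vertex-bound adj P (suc k) bd) f h hf hh))
         (≤-reflexive (E-const (ℕ→ℚ (tri (suc k)) * recip n))) ⟩
  4ℚ * (linConst k * M) + ℕ→ℚ (tri (suc k)) * recip n ∎
  where
  open ≤-Reasoning
  uf = HalfW⇒UnitW hf
  φ b : Weight n
  φ x = K A k (f ⊙ A x) - P * K complete k (f ⊙ complete x)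
  b x = K complete k (f ⊙ complete x)
  ufD : ∀ x → UnitW (f ⊙ complete x)
  ufD x y = Unit-* (uf y) (unit complete-adjacency x y)
  base : ∀ x → ∣ b x - E f ^ℚ k ∣ ≤ ℕ→ℚ (tri (suc k)) * recip n
  base x = begin
    ∣ b x - E f ^ℚ k ∣ ≤⟨ triangle (b x) (E (f ⊙ complete x) ^ℚ k) (E f ^ℚ k) ⟩
    ∣ b x - E (f ⊙ complete x) ^ℚ k ∣ + ∣ E (f ⊙ complete x) ^ℚ k - E f ^ℚ k ∣
      ≤⟨ +-mono-≤ (K-complete k (f ⊙ complete x) (ufD x)) (≤-trans (^-lipschitz (Unit-E (ufD x)) (Unit-E uf) k)
           (*-monoˡ (ℕ→ℚ k) (ℕ→ℚ-nonneg k) (≤-trans (≤-reflexive (cong (λ z → ∣ E (f ⊙ complete x) - z ∣) (sym (*-identityˡ (E f)))))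
             (complete-regular f uf x)))) ⟩
    ℕ→ℚ (tri k) * recip n + ℕ→ℚ k * recip n ≡⟨ sym (*-distribʳ-+ (recip n) (ℕ→ℚ (tri k)) (ℕ→ℚ k)) ⟩
    (ℕ→ℚ (tri k) + ℕ→ℚ k) * recip n         ≡⟨ cong (_* recip n) (sym (ℕ→ℚ-+ (tri k) k)) ⟩
    ℕ→ℚ (tri (suc k)) * recip n ∎
  pointwise : ∀ x → ∣ K A k (f ⊙ A x) - P * E f ^ℚ k ∣ ≤ ∣ φ x ∣ + ℕ→ℚ (tri (suc k)) * recip n
  pointwise x = ≤-trans (triangle (K A k (f ⊙ A x)) (P * b x) (P * E f ^ℚ k)) (+-monoʳ-≤ ∣ φ x ∣ (begin
    ∣ P * b x - P * E f ^ℚ k ∣   ≡⟨ cong ∣_∣ (solve 3 (λ p b e → p :* b :- p :* e := p :* (b :- e)) refl P (b x) (E f ^ℚ k)) ⟩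
    ∣ P * (b x - E f ^ℚ k) ∣     ≡⟨ ∣*∣ˡ P (b x - E f ^ℚ k) (proj₁ uP) ⟩
    P * ∣ b x - E f ^ℚ k ∣       ≤⟨ *-mono (proj₁ uP) (proj₂ uP) (0≤∣p∣ (b x - E f ^ℚ k)) (base x) ⟩
    1ℚ * (ℕ→ℚ (tri (suc k)) * recip n) ≡⟨ *-identityˡ (ℕ→ℚ (tri (suc k)) * recip n) ⟩
    ℕ→ℚ (tri (suc k)) * recip n ∎))

-- Degree regularity

-- The mean absolute difference measures nearness to a constant without naming that constant, so it
-- passes through powers and linear combinations before any density is known.
spread : Weight n → ℚ
spread d = E (λ z → E (λ w → ∣ d z - d w ∣))

one : Weight n
one x = 1ℚ

degree : (Fin n → Weight n) → Weight n → Weight n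
degree A f x = E (f ⊙ A x)

-- The number X z w of k-cliques in N(z) ∩ N(w) is estimated once from the weight f on N(z) and once from f on N(w).
degree-powers-balanced : (A : Fin n → Weight n) → Adjacency A → ∀ {P} → 0ℚ ≤ P → ∀ k {μ} .{{_ : ℕ.NonZero n}} →
  (∀ f → HalfW f → E (λ x → ∣ K A k (f ⊙ A x) - P * E f ^ℚ k ∣) ≤ μ) → ∀ f → HalfW f →
  P * spread (λ z → degree A f z ^ℚ k) ≤ μ + μ
degree-powers-balanced {n} A adj {P} 0≤P k {μ} star f hf = begin
  P * spread D                                  ≡⟨ sym (E-* P (λ z → E (λ w → ∣ D z - D w ∣))) ⟩
  E (λ z → P * E (λ w → ∣ D z - D w ∣))         ≡⟨ E-cong (λ z → sym (E-* P (λ w → ∣ D z - D w ∣))) ⟩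
  E (λ z → E (λ w → P * ∣ D z - D w ∣))         ≤⟨ E-mono (λ z → E-mono (pointwise z)) ⟩
  E (λ z → E (λ w → Y z w + Y w z))             ≡⟨ E-cong (λ z → E-+ (Y z) (λ w → Y w z)) ⟩
  E (λ z → E (Y z) + E (λ w → Y w z))           ≡⟨ E-+ (λ z → E (Y z)) (λ z → E (λ w → Y w z)) ⟩
  E (λ z → E (Y z)) + E (λ z → E (λ w → Y w z)) ≡⟨ cong (E (λ z → E (Y z)) +_) (E-swap (λ z w → Y w z)) ⟩
  E (λ z → E (Y z)) + E (λ z → E (Y z))         ≤⟨ +-mono-≤ (E-upper avg) (E-upper avg) ⟩
  μ + μ ∎
  where
  open ≤-Reasoning
  D : Weight n
  D z = degree A f z ^ℚ k
  X Y : Fin n → Fin n → ℚ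
  X z w = K A k (f ⊙ A z ⊙ A w)
  Y z w = ∣ X z w - P * D z ∣
  X-sym : ∀ z w → X z w ≡ X w z
  X-sym z w = K-cong A k (λ y → solve 3 (λ f a b → f :* a :* b := f :* b :* a) refl (f y) (A z y) (A w y))
  avg : ∀ z → E (Y z) ≤ μ
  avg z = star (f ⊙ A z) (λ y → 0≤* (proj₁ (hf y)) (proj₁ (unit adj z y)) ,
    ≤-trans (*≤ˡ (proj₁ (hf y)) (proj₂ (unit adj z y))) (proj₂ (hf y)))
  pointwise : ∀ z w → P * ∣ D z - D w ∣ ≤ Y z w + Y w z
  pointwise z w = begin
    P * ∣ D z - D w ∣                        ≡⟨ sym (∣*∣ˡ P (D z - D w) 0≤P) ⟩
    ∣ P * (D z - D w) ∣                      ≡⟨ cong ∣_∣ (solve 3 (λ p a b → p :* (a :- b) := p :* a :- p :* b) refl P (D z) (D w)) ⟩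
    ∣ P * D z - P * D w ∣                    ≤⟨ triangle (P * D z) (X z w) (P * D w) ⟩
    ∣ P * D z - X z w ∣ + ∣ X z w - P * D w ∣ ≡⟨ cong₂ _+_ (abs-sym (P * D z) (X z w)) (cong (λ u → ∣ u - P * D w ∣) (X-sym z w)) ⟩
    Y z w + Y w z ∎

-- Go from z to z′ through a third vertex w. By `^-separates` both legs, weighted by d(w)^l, are
-- controlled by differences of (l+1)-st powers. Averaging over w leaves only the mean of d^l as a
-- factor, and no lower bound on d(z) or d(z′) enters.
spread-from-powers : .{{_ : ℕ.NonZero n}} → (d : Weight n) → (∀ x → 0ℚ ≤ d x) → ∀ l →
  spread d * E (λ w → d w ^ℚ l) ≤ 2ℚ * spread (λ z → d z ^ℚ suc l)
spread-from-powers {n} d 0≤d l = begin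
  spread d * Q                                    ≡⟨ sym (E-*ʳ Q (λ z → E (λ w → ∣ d z - d w ∣))) ⟩
  E (λ z → E (λ w → ∣ d z - d w ∣) * Q)           ≡⟨ E-cong (λ z → sym (E-*ʳ Q (λ w → ∣ d z - d w ∣))) ⟩
  E (λ z → E (λ w → ∣ d z - d w ∣ * Q))           ≤⟨ E-mono (λ z → E-mono (pointwise z)) ⟩
  E (λ z → E (λ w → G z + G w))                   ≡⟨ E-cong (λ z → trans (E-+ (λ _ → G z) G) (cong (_+ E G) (E-const (G z)))) ⟩
  E (λ z → G z + E G)                             ≡⟨ trans (E-+ G (λ _ → E G)) (cong (E G +_) (E-const (E G))) ⟩
  E G + E G                                       ≡⟨ solve 1 (λ g → g :+ g := con 2ℚ :* g) refl (E G) ⟩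
  2ℚ * E G ∎
  where
  open ≤-Reasoning
  Q = E (λ w → d w ^ℚ l)
  G : Weight n
  G z = E (λ w → ∣ d z ^ℚ suc l - d w ^ℚ suc l ∣)
  pointwise : ∀ z z′ → ∣ d z - d z′ ∣ * Q ≤ G z + G z′
  pointwise z z′ = begin
    ∣ d z - d z′ ∣ * Q                       ≡⟨ sym (E-* ∣ d z - d z′ ∣ (λ w → d w ^ℚ l)) ⟩
    E (λ w → ∣ d z - d z′ ∣ * d w ^ℚ l)      ≤⟨ E-mono (λ w → begin
      ∣ d z - d z′ ∣ * d w ^ℚ l              ≤⟨ *-monoʳ (d w ^ℚ l) (^-nonneg (0≤d w) l) (triangle (d z) (d w) (d z′)) ⟩
      (∣ d z - d w ∣ + ∣ d w - d z′ ∣) * d w ^ℚ l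
        ≡⟨ *-distribʳ-+ (d w ^ℚ l) ∣ d z - d w ∣ ∣ d w - d z′ ∣ ⟩
      ∣ d z - d w ∣ * d w ^ℚ l + ∣ d w - d z′ ∣ * d w ^ℚ l
        ≡⟨ cong (λ u → ∣ d z - d w ∣ * d w ^ℚ l + u * d w ^ℚ l) (abs-sym (d w) (d z′)) ⟩
      ∣ d z - d w ∣ * d w ^ℚ l + ∣ d z′ - d w ∣ * d w ^ℚ l
        ≤⟨ +-mono-≤ (^-separates (0≤d z) (0≤d w) l) (^-separates (0≤d z′) (0≤d w) l) ⟩
      ∣ d z ^ℚ suc l - d w ^ℚ suc l ∣ + ∣ d z′ ^ℚ suc l - d w ^ℚ suc l ∣ ∎) ⟩
    E (λ w → ∣ d z ^ℚ suc l - d w ^ℚ suc l ∣ + ∣ d z′ ^ℚ suc l - d w ^ℚ suc l ∣)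
      ≡⟨ E-+ (λ w → ∣ d z ^ℚ suc l - d w ^ℚ suc l ∣) (λ w → ∣ d z′ ^ℚ suc l - d w ^ℚ suc l ∣) ⟩
    G z + G z′ ∎

¼ : ℚ
¼ = ½ * ½

-- A weight of at least 1/4 keeps a quarter of every degree, and the cliques rooted at z number at
-- most a power of its degree. Many cliques in total therefore force large degree powers on average.
degree-power-lower : .{{_ : ℕ.NonZero n}} → (A : Fin n → Weight n) → Adjacency A → ∀ l {P} →
  P ≤ 2ℚ * K A (suc (suc l)) one → ∀ f → (∀ x → ¼ ≤ f x) → ¼ ^ℚ l * P ≤ 2ℚ * E (λ z → degree A f z ^ℚ l)
degree-power-lower {n} A adj l {P} P≤ f ¼≤f = begin
  ¼ ^ℚ l * P                                     ≤⟨ *-monoˡ (¼ ^ℚ l) 0≤¼^ P≤ ⟩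
  ¼ ^ℚ l * (2ℚ * K A (suc (suc l)) one)          ≤⟨ *-monoˡ (¼ ^ℚ l) 0≤¼^ (*-monoˡ 2ℚ 0≤2 K≤) ⟩
  ¼ ^ℚ l * (2ℚ * E (λ z → g z ^ℚ l))             ≡⟨ solve 3 (λ a b c → a :* (b :* c) := b :* (a :* c)) refl (¼ ^ℚ l) 2ℚ (E (λ z → g z ^ℚ l)) ⟩
  2ℚ * (¼ ^ℚ l * E (λ z → g z ^ℚ l))             ≡⟨ cong (2ℚ *_) (sym (E-* (¼ ^ℚ l) (λ z → g z ^ℚ l))) ⟩
  2ℚ * E (λ z → ¼ ^ℚ l * g z ^ℚ l)               ≤⟨ *-monoˡ 2ℚ 0≤2 (E-mono (λ z → ≤-trans (≤-reflexive (sym (*-^ ¼ (g z) l)))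
                                                     (^-mono (0≤* 0≤¼ (proj₁ (ug z))) (¼g≤ z) l))) ⟩
  2ℚ * E (λ z → degree A f z ^ℚ l) ∎
  where
  open ≤-Reasoning
  0≤2 = nonNegative⁻¹ 2ℚ
  0≤¼ = nonNegative⁻¹ ¼
  0≤¼^ = ^-nonneg 0≤¼ l
  g : Weight n
  g = degree A one
  uA : ∀ z → UnitW (one ⊙ A z)
  uA z y = Unit-* (0≤1 , ≤-refl) (unit adj z y)
  ug : UnitW g
  ug z = Unit-E (uA z)
  ¼g≤ : ∀ z → ¼ * g z ≤ degree A f z
  ¼g≤ z = ≤-trans (≤-reflexive (sym (E-* ¼ (one ⊙ A z)))) (E-mono (λ y → ≤-trans
    (≤-reflexive (cong (¼ *_) (*-identityˡ (A z y)))) (*-monoʳ (A z y) (proj₁ (unit adj z y)) (¼≤f y))))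
  K≤ : K A (suc (suc l)) one ≤ E (λ z → g z ^ℚ l)
  K≤ = E-mono (λ z → begin
    1ℚ * K A (suc l) (one ⊙ A z)  ≡⟨ *-identityˡ (K A (suc l) (one ⊙ A z)) ⟩
    K A (suc l) (one ⊙ A z)       ≤⟨ K≤E^ A (unit adj) (suc l) (uA z) ⟩
    -- One factor of the degree is given up: the root has l + 1 companions, while
    -- `spread-from-powers` asks for the exponent l.
    g z * g z ^ℚ l                ≤⟨ *-monoʳ (g z ^ℚ l) (^-nonneg (proj₁ (ug z)) l) (proj₂ (ug z)) ⟩
    1ℚ * g z ^ℚ l                 ≡⟨ *-identityˡ (g z ^ℚ l) ⟩
    g z ^ℚ l ∎)

spread-nonneg : (d : Weight n) → 0ℚ ≤ spread d
spread-nonneg d = E-nonneg (λ z → E-nonneg (λ w → 0≤∣p∣ (d z - d w)))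

8ℚ 64ℚ : ℚ
8ℚ  = 4ℚ + 4ℚ
64ℚ = 8ℚ * 8ℚ

-- One factor P is spent on the lower bound for the average of d^l, the other on the comparison of
-- degree powers. 4^l undoes (1/4)^l, and 8 collects the 2 of each of these two bounds and the 2 of
-- `spread-from-powers`.
degree-spread-¼ : .{{_ : ℕ.NonZero n}} → (A : Fin n → Weight n) → Adjacency A → ∀ l {P μ} → 0ℚ ≤ P →
  P ≤ 2ℚ * K A (suc (suc l)) one →
  (∀ f → HalfW f → E (λ x → ∣ K A (suc l) (f ⊙ A x) - P * E f ^ℚ suc l ∣) ≤ μ) →
  ∀ f → HalfW f → (∀ x → ¼ ≤ f x) → P * P * spread (degree A f) ≤ 8ℚ * 4ℚ ^ℚ l * μ
degree-spread-¼ {n} A adj l {P} {μ} 0≤P P≤ star f hf ¼≤f = begin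
  P * P * V                            ≡⟨ trans (sym (*-identityˡ (P * P * V))) (cong (_* (P * P * V)) (sym 4^¼^)) ⟩
  4ℚ ^ℚ l * ¼ ^ℚ l * (P * P * V)       ≡⟨ solve 4 (λ a b p v → a :* b :* (p :* p :* v) := a :* p :* v :* (b :* p)) refl (4ℚ ^ℚ l) (¼ ^ℚ l) P V ⟩
  4ℚ ^ℚ l * P * V * (¼ ^ℚ l * P)       ≤⟨ *-monoˡ (4ℚ ^ℚ l * P * V) (0≤* (0≤* 0≤4^ 0≤P) (spread-nonneg (degree A f)))
                                            (degree-power-lower A adj l P≤ f ¼≤f) ⟩
  4ℚ ^ℚ l * P * V * (2ℚ * Q)           ≡⟨ solve 4 (λ a p v q → a :* p :* v :* (con 2ℚ :* q) := con 2ℚ :* a :* p :* (v :* q)) refl (4ℚ ^ℚ l) P V Q ⟩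
  2ℚ * 4ℚ ^ℚ l * P * (V * Q)           ≤⟨ *-monoˡ (2ℚ * 4ℚ ^ℚ l * P) (0≤* 0≤2·4^ 0≤P)
                                            (spread-from-powers (degree A f) 0≤deg l) ⟩
  2ℚ * 4ℚ ^ℚ l * P * (2ℚ * S)          ≡⟨ solve 3 (λ a p s → con 2ℚ :* a :* p :* (con 2ℚ :* s) := con 2ℚ :* (con 2ℚ :* a) :* (p :* s)) refl (4ℚ ^ℚ l) P S ⟩
  2ℚ * (2ℚ * 4ℚ ^ℚ l) * (P * S)        ≤⟨ *-monoˡ (2ℚ * (2ℚ * 4ℚ ^ℚ l)) (0≤* 0≤2 0≤2·4^)
                                            (degree-powers-balanced A adj 0≤P (suc l) star f hf) ⟩
  2ℚ * (2ℚ * 4ℚ ^ℚ l) * (μ + μ)        ≡⟨ solve 2 (λ a m → con 2ℚ :* (con 2ℚ :* a) :* (m :+ m) := con 8ℚ :* a :* m) refl (4ℚ ^ℚ l) μ ⟩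
  8ℚ * 4ℚ ^ℚ l * μ ∎
  where
  open ≤-Reasoning
  V = spread (degree A f)
  Q = E (λ z → degree A f z ^ℚ l)
  S = spread (λ z → degree A f z ^ℚ suc l)
  0≤2 = nonNegative⁻¹ 2ℚ
  0≤4^ = ^-nonneg (nonNegative⁻¹ 4ℚ) l
  0≤2·4^ : 0ℚ ≤ 2ℚ * 4ℚ ^ℚ l
  0≤2·4^ = 0≤* 0≤2 0≤4^
  0≤deg : ∀ x → 0ℚ ≤ degree A f x
  0≤deg x = E-nonneg (λ y → 0≤* (proj₁ (hf y)) (proj₁ (unit adj x y)))
  4^¼^ : 4ℚ ^ℚ l * ¼ ^ℚ l ≡ 1ℚ
  4^¼^ = trans (sym (*-^ 4ℚ ¼ l)) (1^ l)

-- The weights 1/4 + u/4 and 1/4 both lie in [1/4,1/2], and u is 4 times their difference. Degrees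
-- are linear in the weight, so the two spreads add up with factor 4 each, which gives 64 = 4 (8 +
-- 8).
degree-spread : .{{_ : ℕ.NonZero n}} → (A : Fin n → Weight n) → Adjacency A → ∀ l {P μ} → 0ℚ ≤ P →
  P ≤ 2ℚ * K A (suc (suc l)) one →
  (∀ f → HalfW f → E (λ x → ∣ K A (suc l) (f ⊙ A x) - P * E f ^ℚ suc l ∣) ≤ μ) →
  ∀ u → UnitW u → P * P * spread (degree A u) ≤ 64ℚ * 4ℚ ^ℚ l * μ
degree-spread {n} A adj l {P} {μ} 0≤P P≤ star u uu = begin
  P * P * spread (degree A u)
    ≤⟨ *-monoˡ (P * P) (0≤* 0≤P 0≤P) spread≤ ⟩
  P * P * (4ℚ * spread (degree A (f u)) + 4ℚ * spread (degree A (f o)))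
    ≡⟨ solve 3 (λ p a b → p :* (con 4ℚ :* a :+ con 4ℚ :* b) := con 4ℚ :* (p :* a :+ p :* b)) refl (P * P) (spread (degree A (f u))) (spread (degree A (f o))) ⟩
  4ℚ * (P * P * spread (degree A (f u)) + P * P * spread (degree A (f o)))
    ≤⟨ *-monoˡ 4ℚ (nonNegative⁻¹ 4ℚ) (+-mono-≤ (bound u uu) (bound o (λ _ → ≤-refl , 0≤1))) ⟩
  4ℚ * (8ℚ * 4ℚ ^ℚ l * μ + 8ℚ * 4ℚ ^ℚ l * μ)
    ≡⟨ solve 2 (λ a m → con 4ℚ :* (con 8ℚ :* a :* m :+ con 8ℚ :* a :* m) := con 64ℚ :* a :* m) refl (4ℚ ^ℚ l) μ ⟩
  64ℚ * 4ℚ ^ℚ l * μ ∎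
  where
  open ≤-Reasoning
  0≤¼ = nonNegative⁻¹ ¼
  o : Weight n
  o x = 0ℚ
  f : Weight n → Weight n
  f v x = ¼ + ¼ * v x
  bound : ∀ v → UnitW v → P * P * spread (degree A (f v)) ≤ 8ℚ * 4ℚ ^ℚ l * μ
  bound v uv = degree-spread-¼ A adj l 0≤P P≤ star (f v)
    (λ x → 0≤+ 0≤¼ (0≤* 0≤¼ (proj₁ (uv x))) , +-monoʳ-≤ ¼ (*≤ˡ 0≤¼ (proj₂ (uv x))))
    (λ x → ≤-trans (≤-reflexive (sym (+-identityʳ ¼))) (+-monoʳ-≤ ¼ (0≤* 0≤¼ (proj₁ (uv x)))))
  deg-f : ∀ v z → degree A (f v) z ≡ ¼ * E (A z) + ¼ * degree A v z
  deg-f v z = trans (E-cong (λ y → solve 2 (λ v a → (con ¼ :+ con ¼ :* v) :* a := con ¼ :* a :+ con ¼ :* (v :* a)) refl (v y) (A z y)))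
    (trans (E-+ (λ y → ¼ * A z y) (λ y → ¼ * (v y * A z y))) (cong₂ _+_ (E-* ¼ (A z)) (E-* ¼ (v ⊙ A z))))
  deg-o : ∀ z → degree A o z ≡ 0ℚ
  deg-o z = E-zero (λ y → *-zeroˡ (A z y))
  deg-u : ∀ z → degree A u z ≡ 4ℚ * degree A (f u) z - 4ℚ * degree A (f o) z
  deg-u z = sym (trans (cong₂ (λ a b → 4ℚ * a - 4ℚ * b) (deg-f u z) (trans (deg-f o z) (cong (λ w → ¼ * E (A z) + ¼ * w) (deg-o z))))
    (solve 2 (λ a u → con 4ℚ :* (con ¼ :* a :+ con ¼ :* u) :- con 4ℚ :* (con ¼ :* a :+ con ¼ :* con 0ℚ) := u) refl (E (A z)) (degree A u z)))
  pointwise : ∀ z w → ∣ degree A u z - degree A u w ∣ ≤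
    4ℚ * ∣ degree A (f u) z - degree A (f u) w ∣ + 4ℚ * ∣ degree A (f o) z - degree A (f o) w ∣
  pointwise z w = begin
    ∣ degree A u z - degree A u w ∣    ≡⟨ cong ∣_∣ (trans (cong₂ _-_ (deg-u z) (deg-u w))
      (solve 4 (λ a b c d → (con 4ℚ :* a :- con 4ℚ :* b) :- (con 4ℚ :* c :- con 4ℚ :* d) := con 4ℚ :* (a :- c) :- con 4ℚ :* (b :- d)) refl
        (degree A (f u) z) (degree A (f o) z) (degree A (f u) w) (degree A (f o) w))) ⟩
    ∣ 4ℚ * x - 4ℚ * y ∣                ≤⟨ ∣p-q∣≤∣p∣+∣q∣ (4ℚ * x) (4ℚ * y) ⟩
    ∣ 4ℚ * x ∣ + ∣ 4ℚ * y ∣            ≡⟨ cong₂ _+_ (∣*∣ˡ 4ℚ x (nonNegative⁻¹ 4ℚ)) (∣*∣ˡ 4ℚ y (nonNegative⁻¹ 4ℚ)) ⟩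
    4ℚ * ∣ x ∣ + 4ℚ * ∣ y ∣ ∎
    where
    x = degree A (f u) z - degree A (f u) w
    y = degree A (f o) z - degree A (f o) w
  S : Weight n → Fin n → Weight n
  S v z w = ∣ degree A (f v) z - degree A (f v) w ∣
  spread≤ : spread (degree A u) ≤ 4ℚ * spread (degree A (f u)) + 4ℚ * spread (degree A (f o))
  spread≤ = ≤-trans (E-mono (λ z → E-mono (pointwise z))) (≤-reflexive (trans
    (E-cong (λ z → trans (E-+ (λ w → 4ℚ * S u z w) (λ w → 4ℚ * S o z w)) (cong₂ _+_ (E-* 4ℚ (S u z)) (E-* 4ℚ (S o z)))))
    (trans (E-+ (λ z → 4ℚ * E (S u z)) (λ z → 4ℚ * E (S o z)))
      (cong₂ _+_ (E-* 4ℚ (λ z → E (S u z))) (E-* 4ℚ (λ z → E (S o z)))))))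

deviation≤spread : .{{_ : ℕ.NonZero n}} → (d : Weight n) → E (λ z → ∣ d z - E d ∣) ≤ spread d
deviation≤spread {n} d = E-mono (λ z → begin
  ∣ d z - E d ∣                     ≡⟨ cong (λ a → ∣ a - E d ∣) (sym (E-const (d z))) ⟩
  ∣ E {n} (λ _ → d z) - E d ∣       ≡⟨ cong ∣_∣ (sym (E-sub (λ _ → d z) d)) ⟩
  ∣ E (λ w → d z - d w) ∣           ≤⟨ E-abs (λ w → d z - d w) ⟩
  E (λ w → ∣ d z - d w ∣) ∎)
  where open ≤-Reasoning

-- One γ brings the degree to its mean. By double counting, that mean is the u-weighted average of
-- the unweighted degree, which is itself within γ of its own mean in L¹; this is the second γ.
degrees-regular : .{{_ : ℕ.NonZero n}} → (A : Fin n → Weight n) → Adjacency A → ∀ {γ} →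
  (∀ u → UnitW u → spread (degree A u) ≤ γ) →
  ∀ u → UnitW u → E (λ x → ∣ E (u ⊙ A x) - E (degree A one) * E u ∣) ≤ γ + γ
degrees-regular {n} A adj {γ} sp u uu = begin
  E (λ x → ∣ d x - q * E u ∣)                     ≤⟨ E-mono (λ x → triangle (d x) (E d) (q * E u)) ⟩
  E (λ x → ∣ d x - E d ∣ + ∣ E d - q * E u ∣)     ≡⟨ E-+ (λ x → ∣ d x - E d ∣) (λ _ → ∣ E d - q * E u ∣) ⟩
  E (λ x → ∣ d x - E d ∣) + E {n} (λ _ → ∣ E d - q * E u ∣) ≡⟨ cong (E (λ x → ∣ d x - E d ∣) +_) (E-const ∣ E d - q * E u ∣) ⟩
  E (λ x → ∣ d x - E d ∣) + ∣ E d - q * E u ∣     ≤⟨ +-mono-≤ (≤-trans (deviation≤spread d) (sp u uu)) mean ⟩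
  γ + γ ∎
  where
  open ≤-Reasoning
  d g : Weight n
  d = degree A u
  g = degree A one
  q = E g
  mean : ∣ E d - q * E u ∣ ≤ γ
  mean = begin
    ∣ E d - q * E u ∣                     ≡⟨ cong₂ (λ a b → ∣ a - b ∣) Ed (sym (E-* q u)) ⟩
    ∣ E (λ y → u y * g y) - E (λ y → q * u y) ∣ ≡⟨ cong ∣_∣ (sym (E-sub (λ y → u y * g y) (λ y → q * u y))) ⟩
    ∣ E (λ y → u y * g y - q * u y) ∣     ≤⟨ E-abs (λ y → u y * g y - q * u y) ⟩
    E (λ y → ∣ u y * g y - q * u y ∣)     ≤⟨ E-mono (λ y → begin
      ∣ u y * g y - q * u y ∣             ≡⟨ cong ∣_∣ (solve 3 (λ u g q → u :* g :- q :* u := u :* (g :- q)) refl (u y) (g y) q) ⟩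
      ∣ u y * (g y - q) ∣                 ≡⟨ ∣*∣ˡ (u y) (g y - q) (proj₁ (uu y)) ⟩
      u y * ∣ g y - q ∣                   ≤⟨ *-monoʳ ∣ g y - q ∣ (0≤∣p∣ (g y - q)) (proj₂ (uu y)) ⟩
      1ℚ * ∣ g y - q ∣                    ≡⟨ *-identityˡ ∣ g y - q ∣ ⟩
      ∣ g y - q ∣ ∎) ⟩
    E (λ y → ∣ g y - q ∣)                 ≤⟨ deviation≤spread g ⟩
    spread g                              ≤⟨ sp one (λ _ → 0≤1 , ≤-refl) ⟩
    γ ∎
    where
    Ed : E d ≡ E (λ y → u y * g y)
    Ed = trans (E-swap (λ x y → u y * A x y)) (E-cong (λ y → trans (E-* (u y) (λ x → A x y))
      (cong (u y *_) (E-cong (λ x → trans (symmetric adj x y) (sym (*-identityˡ (A y x))))))))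

-- Constants and the passage from cliques to edges

-- In units of δ: `rootedConst` uses an excess of at most 2 δ and one more δ for the 1/n term.
-- `spreadConst` bounds P² times a degree spread. In `densityConst`, regularity costs twice the
-- spread; it enters tri r times through the clique count and once through the edge count, and the
-- last 1 is the hypothesis on the whole vertex set.
rootedConst spreadConst densityConst : ℕ → ℚ
rootedConst  k = 4ℚ * (linConst k * 2ℚ) + 1ℚ
spreadConst  l = 64ℚ * 4ℚ ^ℚ l * rootedConst (suc l)
densityConst l = (ℕ→ℚ (tri (suc (suc l))) + 1ℚ) * (2ℚ * spreadConst l) + 1ℚ

spreadConst-nonneg : ∀ l → 0ℚ ≤ spreadConst l
spreadConst-nonneg l = 0≤* (0≤* (nonNegative⁻¹ 64ℚ) (^-nonneg (nonNegative⁻¹ 4ℚ) l))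
  (0≤+ (0≤* (nonNegative⁻¹ 4ℚ) (0≤* (linConst-nonneg (suc l)) (nonNegative⁻¹ 2ℚ))) 0≤1)

densityConst-nonneg : ∀ l → 0ℚ ≤ densityConst l
densityConst-nonneg l = 0≤+ (0≤* (0≤+ (ℕ→ℚ-nonneg (tri (suc (suc l)))) 0≤1)
  (0≤* (nonNegative⁻¹ 2ℚ) (spreadConst-nonneg l))) 0≤1

UnitW-indicator : (S : Subset n) → UnitW (indicator S)
UnitW-indicator S x with lookup S x
... | true = 0≤1 , ≤-refl
... | false = ≤-refl , 0≤1

cliqueDefect : (Fin n → Weight n) → ℚ → ℕ → Subset n → ℚ
cliqueDefect A p j S = ∣ K A j (indicator S) - p ^ℚ tri j * E (indicator S) ^ℚ j ∣

-- With m = tri r the exponent is 2m + (m - 1): P² clears the denominator of the spread bound, and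
-- p^(m-1) is lost between q^m ≈ p^m and q ≈ p. The bound on `recip n` absorbs the diagonal terms
-- into δ, and δ + δ ≤ p^m keeps the clique density of the whole graph above p^m / 2.
cliques⇒edges : .{{_ : ℕ.NonZero n}} → (A : Fin n → Weight n) → Adjacency A → ∀ {p} → 0ℚ < p → p ≤ 1ℚ →
  ∀ l {δ} → 0ℚ ≤ δ → (∀ S → cliqueDefect A p (suc (suc l)) S ≤ δ) →
  ℕ→ℚ (tri (suc (suc l))) * recip n ≤ δ → δ + δ ≤ p ^ℚ tri (suc (suc l)) →
  ∀ S → p ^ℚ (tri (suc (suc l)) ℕ.+ tri (suc (suc l)) ℕ.+ (tri (suc l) ℕ.+ l)) * cliqueDefect A p 2 S ≤ densityConst l * δ
cliques⇒edges {n} A adj {p} 0<p p≤1 l {δ} 0≤δ hyp n-large δ-small S = begin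
  p ^ℚ (m ℕ.+ m ℕ.+ m′) * X              ≡⟨ cong (_* X) (trans (^-+ p (m ℕ.+ m) m′) (cong (_* p ^ℚ m′) (^-+ p m m))) ⟩
  P * P * p ^ℚ m′ * X                    ≤⟨ *-monoˡ (P * P * p ^ℚ m′) (0≤* 0≤PP 0≤p^) X≤ ⟩
  P * P * p ^ℚ m′ * (β + ∣ q - p ∣)      ≡⟨ solve 4 (λ a b c d → a :* b :* (c :+ d) := a :* c :* b :+ a :* (d :* b)) refl (P * P) (p ^ℚ m′) β ∣ q - p ∣ ⟩
  P * P * β * p ^ℚ m′ + P * P * (∣ q - p ∣ * p ^ℚ m′)
    ≤⟨ +-mono-≤ (*≤ˡ (0≤* 0≤PP 0≤β) (^≤1 0≤p p≤1 m′)) (*-monoˡ (P * P) 0≤PP q-p≤) ⟩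
  P * P * β + P * P * (ℕ→ℚ m * β + δ)    ≡⟨ solve 4 (λ a b c d → a :* b :+ a :* (c :* b :+ d) := (c :+ con 1ℚ) :* (a :* b) :+ a :* d) refl (P * P) β (ℕ→ℚ m) δ ⟩
  (ℕ→ℚ m + 1ℚ) * (P * P * β) + P * P * δ ≤⟨ +-mono-≤ (≤-reflexive (cong ((ℕ→ℚ m + 1ℚ) *_) PPβ)) (*-monoʳ δ 0≤δ PP≤1) ⟩
  (ℕ→ℚ m + 1ℚ) * (W + W) + 1ℚ * δ        ≡⟨ solve 3 (λ m c d → (m :+ con 1ℚ) :* (c :* d :+ c :* d) :+ con 1ℚ :* d
                                              := ((m :+ con 1ℚ) :* (con 2ℚ :* c) :+ con 1ℚ) :* d) refl (ℕ→ℚ m) (spreadConst l) δ ⟩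
  densityConst l * δ ∎
  where
  open ≤-Reasoning
  r m m′ : ℕ
  r = suc (suc l)
  m = tri r
  m′ = tri (suc l) ℕ.+ l
  m≡ : m ≡ suc m′
  m≡ = ℕₚ.+-suc (tri (suc l)) l
  P = p ^ℚ m
  W = spreadConst l * δ
  0≤p = <⇒≤ 0<p
  0≤p^ = ^-nonneg 0≤p m′
  uP : Unit P
  uP = Unit-^ (0≤p , p≤1) m
  0≤PP : 0ℚ ≤ P * P
  0≤PP = 0≤* (proj₁ uP) (proj₁ uP)
  PP≤1 : P * P ≤ 1ℚ
  PP≤1 = proj₂ (Unit-* uP uP)
  instance
    P-pos : Positive P
    P-pos = positive (^-pos 0<p m)
    PP-pos : Positive (P * P)
    PP-pos = pos*pos⇒pos P P
    PP-nonZero : NonZero (P * P)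
    PP-nonZero = pos⇒nonZero (P * P)
  i : ℚ
  i = 1/ (P * P)
  0≤i : 0ℚ ≤ i
  0≤i = <⇒≤ (positive⁻¹ i {{1/pos⇒pos (P * P)}})
  q : ℚ
  q = E (degree A one)
  uone : UnitW one
  uone x = 0≤1 , ≤-refl
  uq : Unit q
  uq = Unit-E (λ x → Unit-E (λ y → Unit-* (0≤1 , ≤-refl) (unit adj x y)))
  -- The first δ is the hypothesis on S; the second pays for trading the power of the mean for the
  -- complete-graph density.
  excess≤ : ∀ S → ∣ excess A P r (indicator S) ∣ ≤ δ + δ
  excess≤ S = ≤-trans (triangle (K A r f) (P * E f ^ℚ r) (P * K complete r f)) (+-mono-≤ (hyp S) (begin
    ∣ P * E f ^ℚ r - P * K complete r f ∣  ≡⟨ cong ∣_∣ (solve 3 (λ p a b → p :* a :- p :* b := p :* (a :- b)) refl P (E f ^ℚ r) (K complete r f)) ⟩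
    ∣ P * (E f ^ℚ r - K complete r f) ∣    ≡⟨ ∣*∣ˡ P (E f ^ℚ r - K complete r f) (proj₁ uP) ⟩
    P * ∣ E f ^ℚ r - K complete r f ∣      ≡⟨ cong (P *_) (abs-sym (E f ^ℚ r) (K complete r f)) ⟩
    P * ∣ K complete r f - E f ^ℚ r ∣      ≤⟨ *-mono (proj₁ uP) (proj₂ uP) (0≤∣p∣ (K complete r f - E f ^ℚ r))
                                                (≤-trans (K-complete r f (UnitW-indicator S)) n-large) ⟩
    1ℚ * δ                                 ≡⟨ *-identityˡ δ ⟩
    δ ∎))
    where f = indicator S
  star : ∀ f → HalfW f → E (λ x → ∣ K A (suc l) (f ⊙ A x) - P * E f ^ℚ suc l ∣) ≤ rootedConst (suc l) * δ
  star f hf = begin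
    E (λ x → ∣ K A (suc l) (f ⊙ A x) - P * E f ^ℚ suc l ∣)         ≤⟨ rooted-count adj uP (suc l) excess≤ f hf ⟩
    4ℚ * (linConst (suc l) * (δ + δ)) + ℕ→ℚ (tri r) * recip n      ≤⟨ +-monoʳ-≤ (4ℚ * (linConst (suc l) * (δ + δ))) n-large ⟩
    4ℚ * (linConst (suc l) * (δ + δ)) + δ
      ≡⟨ solve 2 (λ c d → con 4ℚ :* (c :* (d :+ d)) :+ d := (con 4ℚ :* (c :* con 2ℚ) :+ con 1ℚ) :* d) refl (linConst (suc l)) δ ⟩
    rootedConst (suc l) * δ ∎
  one≗ : ∀ x → indicator ⊤ x ≡ one x
  one≗ x = cong bit (lookup-replicate x true)
  E-one : E (one {n}) ≡ 1ℚ
  E-one = E-const 1ℚ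
  scale-one : ∀ c j → c * E (one {n}) ^ℚ j ≡ c
  scale-one c j = trans (cong (λ e → c * e ^ℚ j) E-one) (trans (cong (c *_) (1^ j)) (*-identityʳ c))
  K-one : ∣ K A r one - P ∣ ≤ δ
  K-one = subst (_≤ δ) (cong₂ (λ a b → ∣ a - b ∣) (K-cong A r one≗)
    (trans (cong (λ e → P * e ^ℚ r) (E-cong one≗)) (scale-one P r))) (hyp ⊤)
  -- With S the whole vertex set P - K is at most δ, so 2K - P is at least P - 2δ.
  P≤2K : P ≤ 2ℚ * K A r one
  P≤2K = ≤-diff (solve 3 (λ k p d → con 2ℚ :* k :- p := con 2ℚ :* (d :- (p :- k)) :+ (p :- (d :+ d))) refl (K A r one) P δ)
    (0≤+ (0≤* (nonNegative⁻¹ 2ℚ) (0≤d (≤-trans (x≤∣x∣ (P - K A r one)) (≤-trans (≤-reflexive (abs-sym P (K A r one))) K-one))))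
      (0≤d δ-small))
  γ β : ℚ
  γ = i * W
  β = γ + γ
  0≤β : 0ℚ ≤ β
  0≤β = 0≤+ 0≤γ 0≤γ
    where
    0≤γ : 0ℚ ≤ γ
    0≤γ = 0≤* 0≤i (0≤* (spreadConst-nonneg l) 0≤δ)
  PPβ : P * P * β ≡ W + W
  PPβ = trans (solve 3 (λ a i w → a :* (i :* w :+ i :* w) := a :* i :* (w :+ w)) refl (P * P) i W)
    (trans (cong (_* (W + W)) (*-inverseʳ (P * P))) (*-identityˡ (W + W)))
  spread≤ : ∀ u → UnitW u → spread (degree A u) ≤ γ
  spread≤ u uu = begin
    V                    ≡⟨ sym (trans (cong (_* V) (*-inverseˡ (P * P))) (*-identityˡ V)) ⟩
    i * (P * P) * V      ≡⟨ *-assoc i (P * P) V ⟩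
    i * (P * P * V)      ≤⟨ *-monoˡ i 0≤i (degree-spread A adj l (proj₁ uP) P≤2K star u uu) ⟩
    i * (64ℚ * 4ℚ ^ℚ l * (rootedConst (suc l) * δ)) ≡⟨ cong (i *_) (sym (*-assoc (64ℚ * 4ℚ ^ℚ l) (rootedConst (suc l)) δ)) ⟩
    γ ∎
    where V = spread (degree A u)
  -- Regularity around the graph's own density q gives a second count of r-cliques. At j = r and the
  -- weight `one` it meets the hypothesis and ties q to p; at j = 2 it yields the edges.
  q-regular : ∀ j f → UnitW f → ∣ K A j f - q ^ℚ tri j * E f ^ℚ j ∣ ≤ ℕ→ℚ (tri j) * β
  q-regular = counting A (unit adj) uq (degrees-regular A adj spread≤)
  q-p≤ : ∣ q - p ∣ * p ^ℚ m′ ≤ ℕ→ℚ m * β + δ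
  q-p≤ = begin
    ∣ q - p ∣ * p ^ℚ m′              ≤⟨ ^-separates (proj₁ uq) 0≤p m′ ⟩
    ∣ q ^ℚ suc m′ - p ^ℚ suc m′ ∣    ≡⟨ cong (λ j → ∣ q ^ℚ j - p ^ℚ j ∣) (sym m≡) ⟩
    ∣ q ^ℚ m - P ∣                   ≤⟨ triangle (q ^ℚ m) (K A r one) P ⟩
    ∣ q ^ℚ m - K A r one ∣ + ∣ K A r one - P ∣
      ≤⟨ +-mono-≤ (≤-trans (≤-reflexive (trans (abs-sym (q ^ℚ m) (K A r one))
           (cong (λ z → ∣ K A r one - z ∣) (sym (scale-one (q ^ℚ m) r))))) (q-regular r one uone)) K-one ⟩
    ℕ→ℚ m * β + δ ∎
  X = cliqueDefect A p 2 S
  X≤ : X ≤ β + ∣ q - p ∣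
  X≤ = begin
    ∣ K A 2 f - p * 1ℚ * E f ^ℚ 2 ∣  ≤⟨ triangle (K A 2 f) (q * 1ℚ * E f ^ℚ 2) (p * 1ℚ * E f ^ℚ 2) ⟩
    ∣ K A 2 f - q * 1ℚ * E f ^ℚ 2 ∣ + ∣ q * 1ℚ * E f ^ℚ 2 - p * 1ℚ * E f ^ℚ 2 ∣
      ≤⟨ +-mono-≤ (≤-trans (q-regular 2 f uf) (≤-reflexive (*-identityˡ β))) (begin
        ∣ q * 1ℚ * e - p * 1ℚ * e ∣  ≡⟨ cong ∣_∣ (solve 3 (λ q p e → q :* con 1ℚ :* e :- p :* con 1ℚ :* e := e :* (q :- p)) refl q p e) ⟩
        ∣ e * (q - p) ∣              ≡⟨ ∣*∣ˡ e (q - p) (proj₁ ue) ⟩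
        e * ∣ q - p ∣                ≤⟨ *-monoʳ ∣ q - p ∣ (0≤∣p∣ (q - p)) (proj₂ ue) ⟩
        1ℚ * ∣ q - p ∣               ≡⟨ *-identityˡ ∣ q - p ∣ ⟩
        ∣ q - p ∣ ∎) ⟩
    β + ∣ q - p ∣ ∎
    where
    f = indicator S
    uf = UnitW-indicator S
    e = E f ^ℚ 2
    ue : Unit e
    ue = Unit-^ (Unit-E uf) 2

-- Counting copies

T-ext : ∀ {a b} → (T a → T b) → (T b → T a) → a ≡ b
T-ext {true}  {true}  _ _ = refl
T-ext {true}  {false} f _ with () ← f tt
T-ext {false} {true}  _ g with () ← g tt
T-ext {false} {false} _ _ = refl

∧-intro : ∀ {a b} → T a → T b → T (a ∧ b)
∧-intro {true} _ tb = tb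

∧-elim : ∀ {a b} → T (a ∧ b) → T a × T b
∧-elim {true} tb = tt , tb

all-tabulate⁻ : ∀ {a} {A : Set a} {n} (p : A → Bool) (f : Fin n → A) → T (all p (List.tabulate f)) → ∀ i → T (p (f i))
all-tabulate⁻ p f t zero    = proj₁ (∧-elim t)
all-tabulate⁻ p f t (suc i) = all-tabulate⁻ p (f ∘ suc) (proj₂ (∧-elim {p (f zero)} t)) i

all-tabulate⁺ : ∀ {a} {A : Set a} {n} (p : A → Bool) (f : Fin n → A) → (∀ i → T (p (f i))) → T (all p (List.tabulate f))
all-tabulate⁺ {n = zero}  p f t = tt
all-tabulate⁺ {n = suc n} p f t = ∧-intro (t zero) (all-tabulate⁺ p (f ∘ suc) (t ∘ suc))

IsCopy : ∀ {n r} → Graph n → Subset n → Vec (Fin n) r → Set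
IsCopy G S φ = (∀ u → T (lookup S (lookup φ u))) × (∀ u v → u ≢ v → T (adj G (lookup φ u) (lookup φ v)))

isKrCopyIn⇒ : ∀ {n r} (G : Graph n) (S : Subset n) (φ : Vec (Fin n) r) → T (isKrCopyIn G S φ) → IsCopy G S φ
isKrCopyIn⇒ {n} {r} G S φ t = inside , edges
  where
  inS = λ u → lookup φ u ∈ᵇ S
  edge = λ u v → ⌊ u ≟ v ⌋ ∨ (not ⌊ lookup φ u ≟ lookup φ v ⌋ ∧ adj G (lookup φ u) (lookup φ v))
  t′ = ∧-elim {all inS (List.allFin r)} t
  inside : ∀ u → T (lookup S (lookup φ u))
  inside = all-tabulate⁻ inS id (proj₁ t′)
  edges : ∀ u v → u ≢ v → T (adj G (lookup φ u) (lookup φ v))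
  edges u v u≢v with u ≟ v | all-tabulate⁻ (edge u) id (all-tabulate⁻ (λ u → all (edge u) (List.allFin r)) id (proj₂ t′) u) v
  ... | yes u≡v | _ = contradiction u≡v u≢v
  ... | no _    | e = proj₂ (∧-elim {not ⌊ lookup φ u ≟ lookup φ v ⌋} e)

⇒isKrCopyIn : ∀ {n r} (G : Graph n) (S : Subset n) (φ : Vec (Fin n) r) → IsCopy G S φ → T (isKrCopyIn G S φ)
⇒isKrCopyIn {n} {r} G S φ (inside , edges) = ∧-intro
  (all-tabulate⁺ (λ u → lookup φ u ∈ᵇ S) id inside)
  (all-tabulate⁺ (λ u → all (edge u) (List.allFin r)) id (λ u → all-tabulate⁺ (edge u) id (edge-true u)))
  where
  edge = λ u v → ⌊ u ≟ v ⌋ ∨ (not ⌊ lookup φ u ≟ lookup φ v ⌋ ∧ adj G (lookup φ u) (lookup φ v))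
  -- Injectivity of a copy comes from the absence of loops: adjacent images are distinct.
  adjacent⇒distinct : ∀ x y → T (adj G x y) → T (not ⌊ x ≟ y ⌋)
  adjacent⇒distinct x y e with x ≟ y
  ... | yes refl = subst T (irrefl G x) e
  ... | no _     = tt
  edge-true : ∀ u v → T (edge u v)
  edge-true u v with u ≟ v
  ... | yes _  = tt
  ... | no u≢v = ∧-intro (adjacent⇒distinct (lookup φ u) (lookup φ v) (edges u v u≢v)) (edges u v u≢v)

neighbours : Graph n → Subset n → Fin n → Subset n
neighbours G S x = Vec.tabulate (λ y → lookup S y ∧ adj G x y)

-- The edges at the first vertex become membership of the others in S ∩ N(x), which is the recursion
-- of `K` on the level of sets.
isKrCopyIn-∷ : ∀ {n r} (G : Graph n) (S : Subset n) x (φ : Vec (Fin n) r) →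
  isKrCopyIn G S (x ∷ φ) ≡ lookup S x ∧ isKrCopyIn G (neighbours G S x) φ
isKrCopyIn-∷ {n} {r} G S x φ = T-ext to from
  where
  N≡ : ∀ y → lookup (neighbours G S x) y ≡ lookup S y ∧ adj G x y
  N≡ = lookup∘tabulate (λ y → lookup S y ∧ adj G x y)
  to : T (isKrCopyIn G S (x ∷ φ)) → T (lookup S x ∧ isKrCopyIn G (neighbours G S x) φ)
  to t with isKrCopyIn⇒ G S (x ∷ φ) t
  ... | inside , edges = ∧-intro (inside zero) (⇒isKrCopyIn G (neighbours G S x) φ
    ( (λ u → subst T (sym (N≡ (lookup φ u))) (∧-intro (inside (suc u)) (edges zero (suc u) (λ ()))))
    , (λ u v u≢v → edges (suc u) (suc v) (u≢v ∘ suc-injective))))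
  from : T (lookup S x ∧ isKrCopyIn G (neighbours G S x) φ) → T (isKrCopyIn G S (x ∷ φ))
  from t with ∧-elim {lookup S x} t
  ... | x∈S , t′ with isKrCopyIn⇒ G (neighbours G S x) φ t′
  ... | inside , edges = ⇒isKrCopyIn G S (x ∷ φ) (inside′ , edges′)
    where
    split : ∀ u → T (lookup S (lookup φ u)) × T (adj G x (lookup φ u))
    split u = ∧-elim (subst T (N≡ (lookup φ u)) (inside u))
    inside′ : ∀ u → T (lookup S (lookup (x ∷ φ) u))
    inside′ zero    = x∈S
    inside′ (suc u) = proj₁ (split u)
    edges′ : ∀ u v → u ≢ v → T (adj G (lookup (x ∷ φ) u) (lookup (x ∷ φ) v))
    edges′ zero    zero    u≢v = contradiction refl u≢v
    edges′ zero    (suc v) u≢v = proj₂ (split v)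
    edges′ (suc u) zero    u≢v = subst T (adj-sym G x (lookup φ u)) (proj₂ (split u))
    edges′ (suc u) (suc v) u≢v = edges u v (u≢v ∘ cong suc)

sum-concatMap-tabulate : ∀ {a b} {A : Set a} {B : Set b} {n} (F : B → ℕ) (g : A → List B) (h : Fin n → A) →
  ℕ→ℚ (sumℕ (List.map F (concatMap g (List.tabulate h)))) ≡ sum (λ i → ℕ→ℚ (sumℕ (List.map F (g (h i)))))
sum-concatMap-tabulate {n = zero}  F g h = refl
sum-concatMap-tabulate {n = suc n} F g h = begin
  ℕ→ℚ (sumℕ (List.map F (g (h zero) List.++ rest)))                     ≡⟨ cong (ℕ→ℚ ∘ sumℕ) (Listₚ.map-++ F (g (h zero)) rest) ⟩
  ℕ→ℚ (sumℕ (List.map F (g (h zero)) List.++ List.map F rest))          ≡⟨ cong ℕ→ℚ (sum-++ (List.map F (g (h zero))) (List.map F rest)) ⟩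
  ℕ→ℚ (sumℕ (List.map F (g (h zero))) ℕ.+ sumℕ (List.map F rest))       ≡⟨ ℕ→ℚ-+ (sumℕ (List.map F (g (h zero)))) (sumℕ (List.map F rest)) ⟩
  ℕ→ℚ (sumℕ (List.map F (g (h zero)))) + ℕ→ℚ (sumℕ (List.map F rest))   ≡⟨ cong (ℕ→ℚ (sumℕ (List.map F (g (h zero)))) +_) (sum-concatMap-tabulate F g (h ∘ suc)) ⟩
  ℕ→ℚ (sumℕ (List.map F (g (h zero)))) + sum (λ i → ℕ→ℚ (sumℕ (List.map F (g (h (suc i)))))) ∎
  where
  open ≡-Reasoning
  rest = concatMap g (List.tabulate (h ∘ suc))

sum-guard : ∀ {a} {A : Set a} b (c : A → Bool) xs →
  ℕ→ℚ (sumℕ (List.map (λ φ → if b ∧ c φ then 1 else 0) xs)) ≡ bit b * ℕ→ℚ (sumℕ (List.map (λ φ → if c φ then 1 else 0) xs))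
sum-guard true  c xs = sym (*-identityˡ _)
sum-guard false c xs = trans (cong ℕ→ℚ (zeros xs)) (sym (*-zeroˡ (ℕ→ℚ (sumℕ (List.map (λ φ → if c φ then 1 else 0) xs)))))
  where
  zeros : ∀ xs → sumℕ (List.map (λ φ → 0) xs) ≡ 0
  zeros []       = refl
  zeros (x ∷ xs) = zeros xs

copiesK-suc : (G : Graph n) (S : Subset n) → ∀ r →
  ℕ→ℚ (copiesK G S (suc r)) ≡ sum (λ x → indicator S x * ℕ→ℚ (copiesK G (neighbours G S x) r))
copiesK-suc {n} G S r = trans (sum-concatMap-tabulate (λ φ → if isKrCopyIn G S φ then 1 else 0) (λ x → List.map (x ∷_) (maps n r)) id)
  (sum-cong-≗ λ x → trans (cong (ℕ→ℚ ∘ sumℕ) (trans (sym (Listₚ.map-∘ (maps n r)))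
      (Listₚ.map-cong (λ φ → cong (λ b → if b then 1 else 0) (isKrCopyIn-∷ G S x φ)) (maps n r))))
    (sum-guard (lookup S x) (isKrCopyIn G (neighbours G S x)) (maps n r)))

adjacency : Graph n → Fin n → Weight n
adjacency G x y = bit (adj G x y)

adjacency-Adjacency : (G : Graph n) → Adjacency (adjacency G)
adjacency-Adjacency G = record
  { symmetric = λ x y → cong bit (adj-sym G x y)
  ; loopless  = λ x → cong bit (irrefl G x)
  ; unit      = λ x y → Unit-bit (adj G x y)
  }
  where
  Unit-bit : ∀ b → Unit (bit b)
  Unit-bit true  = 0≤1 , ≤-refl
  Unit-bit false = ≤-refl , 0≤1

bit-∧ : ∀ a b → bit (a ∧ b) ≡ bit a * bit b
bit-∧ true  b = sym (*-identityˡ (bit b))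
bit-∧ false b = sym (*-zeroˡ (bit b))

sum≡n*E : .{{_ : ℕ.NonZero n}} → (f : Weight n) → sum f ≡ ℕ→ℚ n * E f
sum≡n*E {n} f = sym (trans (sym (*-assoc (ℕ→ℚ n) (recip n) (sum f)))
  (trans (cong (_* sum f) (recip-inverse n)) (*-identityˡ (sum f))))

copiesK≡K : .{{_ : ℕ.NonZero n}} → (G : Graph n) → ∀ r (S : Subset n) →
  ℕ→ℚ (copiesK G S r) ≡ ℕ→ℚ n ^ℚ r * K (adjacency G) r (indicator S)
copiesK≡K G zero    S = refl
copiesK≡K {n} G (suc r) S = begin
  ℕ→ℚ (copiesK G S (suc r))                                            ≡⟨ copiesK-suc G S r ⟩
  sum (λ x → indicator S x * ℕ→ℚ (copiesK G (neighbours G S x) r))     ≡⟨ sum-cong-≗ (λ x → step x) ⟩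
  sum (λ x → N * (indicator S x * k x))                                ≡⟨ sym (*-distribˡ-sum N (λ x → indicator S x * k x)) ⟩
  N * sum (λ x → indicator S x * k x)                                  ≡⟨ cong (N *_) (sum≡n*E (λ x → indicator S x * k x)) ⟩
  N * (ℕ→ℚ n * E (λ x → indicator S x * k x))
    ≡⟨ solve 3 (λ a b c → a :* (b :* c) := b :* a :* c) refl N (ℕ→ℚ n) (E (λ x → indicator S x * k x)) ⟩
  ℕ→ℚ n * N * E (λ x → indicator S x * k x) ∎
  where
  open ≡-Reasoning
  N = ℕ→ℚ n ^ℚ r
  k : Weight n
  k x = K (adjacency G) r (indicator S ⊙ adjacency G x)
  step : ∀ x → indicator S x * ℕ→ℚ (copiesK G (neighbours G S x) r) ≡ N * (indicator S x * k x)
  step x = trans (cong (indicator S x *_) (trans (copiesK≡K G r (neighbours G S x)) (cong (N *_) (K-cong (adjacency G) r (λ y →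
      trans (cong bit (lookup∘tabulate (λ y → lookup S y ∧ adj G x y) y)) (bit-∧ (lookup S y) (adj G x y)))))))
    (solve 3 (λ a b c → a :* (b :* c) := b :* (a :* c)) refl (indicator S x) N (k x))

card≡sum : (S : Subset n) → ℕ→ℚ (card S) ≡ sum (indicator S)
card≡sum []          = refl
card≡sum (true ∷ S)  = trans (ℕ→ℚ-suc (card S)) (cong (1ℚ +_) (card≡sum S))
card≡sum (false ∷ S) = trans (card≡sum S) (sym (+-identityˡ (sum (indicator S))))

C2≡tri : ∀ j → j C 2 ≡ tri j
C2≡tri zero    = refl
C2≡tri (suc j) = trans (sym (nCk+nC[k+1]≡[n+1]C[k+1] j 1))
  (trans (cong₂ ℕ._+_ (nC1≡n j) (C2≡tri j)) (ℕₚ.+-comm j (tri j)))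

discrepancy-normalised : .{{_ : ℕ.NonZero n}} → (G : Graph n) → ∀ p r S →
  ∣ ℕ→ℚ (copiesK G S r) - (p ^ℚ (r C 2)) * (ℕ→ℚ (card S) ^ℚ r) ∣ ≡ ℕ→ℚ n ^ℚ r * cliqueDefect (adjacency G) p r S
discrepancy-normalised {n} G p r S = begin
  ∣ ℕ→ℚ (copiesK G S r) - (p ^ℚ (r C 2)) * (ℕ→ℚ (card S) ^ℚ r) ∣
    ≡⟨ cong₂ (λ a b → ∣ a - b ∣) (copiesK≡K G r S) (cong₂ (λ i s → p ^ℚ i * s ^ℚ r) (C2≡tri r) (trans (card≡sum S) (sum≡n*E (indicator S)))) ⟩
  ∣ N * k - p ^ℚ tri r * (ℕ→ℚ n * e) ^ℚ r ∣
    ≡⟨ cong (λ z → ∣ N * k - p ^ℚ tri r * z ∣) (*-^ (ℕ→ℚ n) e r) ⟩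
  ∣ N * k - p ^ℚ tri r * (N * e ^ℚ r) ∣
    ≡⟨ cong ∣_∣ (solve 4 (λ n k p e → n :* k :- p :* (n :* e) := n :* (k :- p :* e)) refl N k (p ^ℚ tri r) (e ^ℚ r)) ⟩
  ∣ N * (k - p ^ℚ tri r * e ^ℚ r) ∣
    ≡⟨ ∣*∣ˡ N (k - p ^ℚ tri r * e ^ℚ r) (^-nonneg (ℕ→ℚ-nonneg n) r) ⟩
  N * cliqueDefect (adjacency G) p r S ∎
  where
  open ≡-Reasoning
  N = ℕ→ℚ n ^ℚ r
  k = K (adjacency G) r (indicator S)
  e = E (indicator S)

-- Choice of n and of the exponent of p

archimedean : ∀ x → Σ ℕ λ N → x ≤ ℕ→ℚ N
archimedean x@(mkℚ a d _) = ℤ.∣ a ∣ , subst (x ≤_) (sym (ℕ→ℚ-mkℚ ℤ.∣ a ∣)) (*≤* (begin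
  a ℤ.* ℤ.+ 1                  ≡⟨ ℤₚ.*-identityʳ a ⟩
  a                            ≤⟨ i≤∣i∣ a ⟩
  ℤ.+ ℤ.∣ a ∣                  ≡⟨ sym (ℤₚ.*-identityʳ (ℤ.+ ℤ.∣ a ∣)) ⟩
  ℤ.+ ℤ.∣ a ∣ ℤ.* ℤ.+ 1        ≤⟨ ℤₚ.*-monoˡ-≤-nonNeg (ℤ.+ ℤ.∣ a ∣) (ℤ.+≤+ (ℕ.s≤s ℕ.z≤n)) ⟩
  ℤ.+ ℤ.∣ a ∣ ℤ.* ℤ.+ suc d ∎))
  where
  open ℤₚ.≤-Reasoning
  i≤∣i∣ : ∀ i → i ℤ.≤ ℤ.+ ℤ.∣ i ∣
  i≤∣i∣ (ℤ.+ _)      = ℤₚ.≤-refl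
  i≤∣i∣ (ℤ.-[1+ _ ]) = ℤ.-≤+

recip-eventually-small : ∀ t {δ} → 0ℚ < δ → Σ ℕ λ N → ∀ n .{{_ : ℕ.NonZero n}} → N ℕ.≤ n → t * recip n ≤ δ
recip-eventually-small t {δ} 0<δ = proj₁ bound , λ n N≤n → begin
  t * recip n                ≡⟨ sym (trans (solve 4 (λ δ i t r → δ :* (t :* i) :* r := δ :* i :* (t :* r)) refl δ (1/ δ) t (recip n))
                                  (trans (cong (_* (t * recip n)) (*-inverseʳ δ)) (*-identityˡ (t * recip n)))) ⟩
  δ * (t * 1/ δ) * recip n   ≤⟨ *-monoʳ (recip n) (recip-nonneg n) (*-monoˡ δ (<⇒≤ 0<δ) (≤-trans (proj₂ bound) (ℕ→ℚ-mono N≤n))) ⟩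
  δ * ℕ→ℚ n * recip n        ≡⟨ trans (*-assoc δ (ℕ→ℚ n) (recip n)) (trans (cong (δ *_) (recip-inverse n)) (*-identityʳ δ)) ⟩
  δ ∎
  where
  open ≤-Reasoning
  instance
    δ-nonZero : NonZero δ
    δ-nonZero = pos⇒nonZero δ {{positive 0<δ}}
  bound = archimedean (t * 1/ δ)

0<* : ∀ {a b} → 0ℚ < a → 0ℚ < b → 0ℚ < a * b
0<* {a} {b} 0<a 0<b = positive⁻¹ (a * b) {{pos*pos⇒pos a {{positive 0<a}} b {{positive 0<b}}}}

-- A j by j square splits into two triangles and the diagonal.
tri+tri+j≡j*j : ∀ j → tri j ℕ.+ tri j ℕ.+ j ≡ j ℕ.* j
tri+tri+j≡j*j zero    = refl
tri+tri+j≡j*j (suc j) = begin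
  tri j ℕ.+ j ℕ.+ (tri j ℕ.+ j) ℕ.+ suc j  ≡⟨ ℕ-solve 2 (λ t j → t ⊕ j ⊕ (t ⊕ j) ⊕ (κ 1 ⊕ j) ≐ κ 1 ⊕ (j ⊕ (j ⊕ (t ⊕ t ⊕ j)))) refl (tri j) j ⟩
  suc (j ℕ.+ (j ℕ.+ (tri j ℕ.+ tri j ℕ.+ j))) ≡⟨ cong (λ z → suc (j ℕ.+ (j ℕ.+ z))) (tri+tri+j≡j*j j) ⟩
  suc (j ℕ.+ (j ℕ.+ j ℕ.* j))              ≡⟨ cong (λ z → suc (j ℕ.+ z)) (sym (ℕₚ.*-suc j j)) ⟩
  suc j ℕ.* suc j ∎
  where
  open ≡-Reasoning
  open ℕ-Solver using () renaming (solve to ℕ-solve; _:+_ to _⊕_; _:=_ to _≐_; con to κ)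

-- Two triangles fit into one square of side r, and the remaining summand is smaller than a single
-- triangle, so two squares suffice.
exponent-bound : ∀ l → let r = suc (suc l) in tri r ℕ.+ tri r ℕ.+ (tri (suc l) ℕ.+ l) ℕ.≤ 2 ℕ.* r ℕ.* r
exponent-bound l = begin
  tri r ℕ.+ tri r ℕ.+ (tri (suc l) ℕ.+ l)  ≤⟨ ℕₚ.+-mono-≤ tri+tri≤ (ℕₚ.≤-trans (ℕₚ.+-monoʳ-≤ (tri (suc l)) (ℕₚ.n≤1+n l)) (ℕₚ.≤-trans (ℕₚ.m≤m+n (tri r) (tri r)) tri+tri≤)) ⟩
  r ℕ.* r ℕ.+ r ℕ.* r                      ≡⟨ sym (ℕₚ.*-distribʳ-+ r r r) ⟩
  (r ℕ.+ r) ℕ.* r                          ≡⟨ cong (λ z → (r ℕ.+ z) ℕ.* r) (sym (ℕₚ.+-identityʳ r)) ⟩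
  2 ℕ.* r ℕ.* r ∎
  where
  open ℕₚ.≤-Reasoning
  r = suc (suc l)
  tri+tri≤ : tri r ℕ.+ tri r ℕ.≤ r ℕ.* r
  tri+tri≤ = ℕₚ.≤-trans (ℕₚ.m≤m+n (tri r ℕ.+ tri r) r) (ℕₚ.≤-reflexive (tri+tri+j≡j*j r))

theorem1p1 : (r : ℕ) → 3 ℕ.≤ r →
    Σ ℚ λ c → 0ℚ < c ×
    ((p ε : ℚ) → 0ℚ < ε → ε < 1ℚ → 0ℚ < p → p < 1ℚ →
    Σ ℕ λ N → (n : ℕ) → N ℕ.≤ n → (G : Graph n) →
    PstarK G r p (c * (p ^ℚ (2 ℕ.* r ℕ.* r)) * ε) →
    PstarK G 2 p ε)
theorem1p1 (suc zero) (ℕ.s≤s ())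
theorem1p1 r@(suc (suc l)) _ = c , 0<c , main
  where
  -- The summand `densityConst l` makes the final error at most ε, and the summand 2 makes 2c at
  -- most 1, which keeps δ + δ below p^m.
  B : ℚ
  B = densityConst l + 2ℚ
  instance
    B-pos : Positive B
    B-pos = nonNeg+pos⇒pos (densityConst l) {{nonNegative (densityConst-nonneg l)}} 2ℚ
    B-nonZero : NonZero B
    B-nonZero = pos⇒nonZero B
  c : ℚ
  c = 1/ B
  0<c : 0ℚ < c
  0<c = positive⁻¹ c {{1/pos⇒pos B}}
  0≤c = <⇒≤ 0<c
  cB≡ : c * densityConst l + (c + c) ≡ 1ℚ
  cB≡ = trans (solve 2 (λ c d → c :* d :+ (c :+ c) := c :* (d :+ con 2ℚ)) refl c (densityConst l)) (*-inverseˡ B)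
  cD≤1 : c * densityConst l ≤ 1ℚ
  cD≤1 = ≤-diff (trans (cong (λ z → z - c * densityConst l) (sym cB≡)) (solve 2 (λ a b → a :+ b :- a := b) refl (c * densityConst l) (c + c)))
    (0≤+ 0≤c 0≤c)
  2c≤1 : c + c ≤ 1ℚ
  2c≤1 = ≤-diff (trans (cong (λ z → z - (c + c)) (sym cB≡)) (solve 2 (λ a b → a :+ b :- b := a) refl (c * densityConst l) (c + c)))
    (0≤* 0≤c (densityConst-nonneg l))

  main : (p ε : ℚ) → 0ℚ < ε → ε < 1ℚ → 0ℚ < p → p < 1ℚ →
    Σ ℕ λ N → (n : ℕ) → N ℕ.≤ n → (G : Graph n) →
    PstarK G r p (c * (p ^ℚ (2 ℕ.* r ℕ.* r)) * ε) → PstarK G 2 p ε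
  -- The successor forces n to be nonzero, so that `recip n` is a true inverse and averages of
  -- constants are exact.
  main p ε 0<ε ε<1 0<p p<1 = suc (proj₁ large) , graphs
    where
    0≤p = <⇒≤ 0<p
    p≤1 = <⇒≤ p<1
    0≤ε = <⇒≤ 0<ε
    w = p ^ℚ (2 ℕ.* r ℕ.* r)
    0≤w = ^-nonneg 0≤p (2 ℕ.* r ℕ.* r)
    δ : ℚ
    δ = c * w * ε
    0<δ : 0ℚ < δ
    0<δ = 0<* (0<* 0<c (^-pos 0<p (2 ℕ.* r ℕ.* r))) 0<ε
    large = recip-eventually-small (ℕ→ℚ (tri r)) 0<δ
    e = tri r ℕ.+ tri r ℕ.+ (tri (suc l) ℕ.+ l)
    w≤p^e : w ≤ p ^ℚ e
    w≤p^e = ^-antimono 0≤p p≤1 (exponent-bound l)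
    w≤p^tri : w ≤ p ^ℚ tri r
    w≤p^tri = ≤-trans w≤p^e (^-antimono 0≤p p≤1
      (ℕₚ.≤-trans (ℕₚ.m≤m+n (tri r) (tri r)) (ℕₚ.m≤m+n (tri r ℕ.+ tri r) (tri (suc l) ℕ.+ l))))
    δ-small : δ + δ ≤ p ^ℚ tri r
    δ-small = begin
      c * w * ε + c * w * ε   ≡⟨ solve 3 (λ c w e → c :* w :* e :+ c :* w :* e := w :* e :* (c :+ c)) refl c w ε ⟩
      w * ε * (c + c)         ≤⟨ *≤ˡ (0≤* 0≤w 0≤ε) 2c≤1 ⟩
      w * ε                   ≤⟨ *≤ˡ 0≤w (<⇒≤ ε<1) ⟩
      w                       ≤⟨ w≤p^tri ⟩
      p ^ℚ tri r ∎
      where open ≤-Reasoning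

    graphs : (n : ℕ) → suc (proj₁ large) ℕ.≤ n → (G : Graph n) → PstarK G r p δ → PstarK G 2 p ε
    graphs n@(suc _) N<n G hyp S = begin
      ∣ ℕ→ℚ (copiesK G S 2) - (p ^ℚ (2 C 2)) * (ℕ→ℚ (card S) ^ℚ 2) ∣   ≡⟨ discrepancy-normalised G p 2 S ⟩
      ℕ→ℚ n ^ℚ 2 * X        ≤⟨ *-monoˡ (ℕ→ℚ n ^ℚ 2) (^-nonneg (ℕ→ℚ-nonneg n) 2) X≤ε ⟩
      ℕ→ℚ n ^ℚ 2 * ε        ≡⟨ *-comm (ℕ→ℚ n ^ℚ 2) ε ⟩
      ε * ℕ→ℚ n ^ℚ 2 ∎
      where
      open ≤-Reasoning
      A = adjacency G
      0<n^ : ∀ j → 0ℚ < ℕ→ℚ n ^ℚ j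
      0<n^ = ^-pos (<-≤-trans (positive⁻¹ 1ℚ) (ℕ→ℚ-mono {1} {n} (ℕ.s≤s ℕ.z≤n)))
      cliques : ∀ S → cliqueDefect A p r S ≤ δ
      cliques S = *-cancelˡ-≤-pos (ℕ→ℚ n ^ℚ r) {{positive (0<n^ r)}} (begin
        ℕ→ℚ n ^ℚ r * cliqueDefect A p r S   ≡⟨ sym (discrepancy-normalised G p r S) ⟩
        ∣ ℕ→ℚ (copiesK G S r) - (p ^ℚ (r C 2)) * (ℕ→ℚ (card S) ^ℚ r) ∣  ≤⟨ hyp S ⟩
        δ * ℕ→ℚ n ^ℚ r                      ≡⟨ *-comm δ (ℕ→ℚ n ^ℚ r) ⟩
        ℕ→ℚ n ^ℚ r * δ ∎)
      X = cliqueDefect A p 2 S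
      -- δ carries p^(2r²), which is at most the power p^e lost on the way; cancelling p^e leaves ε.
      X≤ε : X ≤ ε
      X≤ε = *-cancelˡ-≤-pos (p ^ℚ e) {{positive (^-pos 0<p e)}} (begin
        p ^ℚ e * X                   ≤⟨ cliques⇒edges A (adjacency-Adjacency G) 0<p p≤1 l (<⇒≤ 0<δ) cliques
                                          (proj₂ large n (ℕₚ.<⇒≤ N<n)) δ-small S ⟩
        densityConst l * (c * w * ε) ≡⟨ solve 4 (λ d c w e → d :* (c :* w :* e) := w :* e :* (c :* d)) refl (densityConst l) c w ε ⟩
        w * ε * (c * densityConst l) ≤⟨ *≤ˡ (0≤* 0≤w 0≤ε) cD≤1 ⟩
        w * ε                        ≤⟨ *-monoʳ ε 0≤ε w≤p^e ⟩
        p ^ℚ e * ε ∎)
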